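{- Let $G$ be the group of one of Constructions B, C, D in the context, let $p^e$ be the order of $g$ (so $p^e=p$ for Constructions B and C and $p^e=9$ for Construction D), and assume $l>1$. Then the nilpotency class of $G$ lies in the interval $[2p^e,3p^e]$.
   Context: Pairs $(A,\sigma)$, $A\in\mathrm{GL}(4,q)$, $\sigma\in\mathrm{Aut}(\mathbb{F}_q)$, multiply by $(A_1,\sigma_1)\circ(A_2,\sigma_2)=(A_1^{\sigma_2}A_2,\sigma_1\sigma_2)$ ($A^\sigma$: $\sigma$ applied entrywise). $E(a,b,c,t)$ is the matrix with rows $(1,0,0,0),(-c,1,0,0),(b-ct,t,1,0),(a,b,c,1)$. Given $T,\theta$ put $\mathfrak{g}_{a,b,c}=(E(a,b,c,T(a,b,c)),\theta_{a,b,c})$. $\mathrm{tr}=\mathrm{tr}_{\mathbb{F}_q/\mathbb{F}_p}$. Construction B: $q=p^{pl}$, $p$ odd, $g(x)=x^{p^l}$; $S_1$ a reduced linearized polynomial with coefficients in $\mathbb{F}_{p^l}$; $\mu_C\in\mathbb{F}_{p^l}^*$; $\theta_{a,b,c}=g^{\mathrm{tr}(\mu_Cc)}$, $T(a,b,c)=S_1(c)$; $G=\{\mathfrak{g}_{a,b,c}:a,b,c\in\mathbb{F}_q\}$. Construction C: $q=p^{pl}$, $p$ odd, $g(x)=x^{p^l}$; $\mu_B\in\mathbb{F}_{p^l}^*$; $s_i\in\mathbb{F}_{p^l}$ ($0\le i\le pl-1$) with $\mu_Bs_i-s_{pl-i}^{p^i}\mu_B^{p^i}=0$ for $1\le i\le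 pl-1$; $S_1=\sum s_iX^{p^i}$, $Q(x)=-\mathrm{tr}(\mu_BxS_1(x))$; $\theta_{a,b,c}=g^{\frac12Q(c)+\mathrm{tr}(\mu_Bb)}$, $T(a,b,c)=S_1(c)$; $G=\{\mathfrak{g}_{a,b,c}\}$. Construction D: $p=3$, $q=3^{9l}$, $g(x)=x^{3^l}$, $g_1=g^3$; $u\in\mathbb{F}_{3^{3l}}$ with $\mu_C=u-u^g\in\mathbb{F}_{3^l}^*$; $t_C$ with $\lambda_C=\mathrm{tr}_{\mathbb{F}_q/\mathbb{F}_3}(\mu_Ct_C)\ne0$; $\mu_B\in\mathbb{F}_{3^l}^*$; $s_i\in\mathbb{F}_{3^l}$ with $-\mu_Bs_i+s_{9l-i}^{3^i}\mu_B^{3^i}=\mu_Cu^{3^i}-u\mu_C^{3^i}$, $1\le i\le 9l-1$; $\alpha\in\mathbb{F}_{3^{3l}}$, $\lambda\in\mathbb{F}_3$ with $g(\alpha)-\alpha=\lambda_Cu+\lambda\mu_C$; $S_1=\sum s_iX^{3^i}$, $Q(x)=-\mathrm{tr}_{\mathbb{F}_q/\mathbb{F}_3}(\mu_BxS_1(x))$, $K=\{z:\mathrm{tr}_{\mathbb{F}_q/\mathbb{F}_3}(\mu_Cz)=0\}$; for $a,b\in\mathbb{F}_q$, $c\in K$, $\mathfrak{g}_{a,b,c}=(E(a,b,c,S_1(c)),g_1^{\frac12Q(c)+\mathrm{tr}_{\mathbb{F}_q/\mathbb{F}_3}(\alpha c+\mu_Bb)})$; $G=\langle\{\mathfrak{g}_{a,b,c}:a,b\in\mathbb{F}_q,c\in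 K\},(E(0,0,t_C,S_1(t_C)),g)\rangle$. -}

module Defs where

open import Level using (0ℓ)
open import Data.Nat as ℕ using (ℕ; zero; suc; _≤_; _<_)
open import Data.Fin using (Fin; zero; suc)
open import Data.Product using (Σ; ∃; _×_; _,_)
open import Data.Sum using (_⊎_)
open import Relation.Binary.PropositionalEquality using (_≡_; _≢_)
open import Relation.Nullary using (¬_; yes; no)
import Data.Fin
open import Function.Bundles using (_↔_)
open import Algebra.Structures using (IsCommutativeRing)

record FiniteField : Set₁ where
  infixl 6 _+_
  infixl 7 _*_
  field
    Carrier  : Set
    _+_ _*_  : Carrier → Carrier → Carrier
    -_       : Carrier → Carrier
    0# 1#    : Carrier
    _⁻¹      : Carrier → Carrier
    isCommutativeRing : IsCommutativeRing _≡_ _+_ _*_ -_ 0# 1#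
    0≢1      : 0# ≢ 1#
    inverseʳ : ∀ x → x ≢ 0# → x * (x ⁻¹) ≡ 1#
    size     : ℕ
    enum     : Carrier ↔ Fin size

-- Everything below is relative to a finite field K and a prime p
-- (intended to be the characteristic of K, i.e. |K| is a power of p).

module FieldDefs (K : FiniteField) (p : ℕ) where
  open FiniteField K public

  F : Set
  F = Carrier

  infixl 6 _-_
  _-_ : F → F → F
  x - y = x + (- y)

  infixr 8 _^_
  _^_ : F → ℕ → F
  x ^ zero  = 1#
  x ^ suc n = x * (x ^ n)

  ι : ℕ → F
  ι zero    = 0#
  ι (suc n) = 1# + ι n

  Σ< : ℕ → (ℕ → F) → F
  Σ< zero    f = 0#
  Σ< (suc n) f = Σ< n f + f n

  frob : ℕ → F → F
  frob k x = x ^ (p ℕ.^ k)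

  -- "x lies in the subfield F_{p^m}"
  InSub : ℕ → F → Set
  InSub m x = frob m x ≡ x

  -- absolute trace tr_{F_q/F_p}, where q = p^n
  tr : ℕ → F → F
  tr n x = Σ< n (λ i → frob i x)

  linPoly : ℕ → (ℕ → F) → F → F
  linPoly n s x = Σ< n (λ i → s i * frob i x)

  -- 4×4 matrices and the semilinear group ΓL(4,q) ⊇ pairs (A,σ),
  -- σ = Frobenius power x ↦ x^(p^k) represented by k.

  Mat : Set
  Mat = Fin 4 → Fin 4 → F

  _⊛_ : Mat → Mat → Mat
  (A ⊛ B) i j = A i zero * B zero j + A i (suc zero) * B (suc zero) j
              + A i (suc (suc zero)) * B (suc (suc zero)) j
              + A i (suc (suc (suc zero))) * B (suc (suc (suc zero))) j

  _^σ_ : Mat → ℕ → Mat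
  (A ^σ k) i j = frob k (A i j)

  Imat : Mat
  Imat i j with i Data.Fin.≟ j
  ... | yes _ = 1#
  ... | no  _ = 0#

  Elem : Set
  Elem = Mat × ℕ

  _∘ₑ_ : Elem → Elem → Elem
  (A₁ , k₁) ∘ₑ (A₂ , k₂) = ((A₁ ^σ k₂) ⊛ A₂ , k₁ ℕ.+ k₂)

  one : Elem
  one = (Imat , 0)

  _≈_ : Elem → Elem → Set
  (A , k) ≈ (B , m) = (∀ i j → A i j ≡ B i j) × (∀ x → frob k x ≡ frob m x)

  E : F → F → F → F → Mat
  E a b c t zero zero = 1#
  E a b c t zero (suc _) = 0#
  E a b c t (suc zero) zero = - c
  E a b c t (suc zero) (suc zero) = 1#
  E a b c t (suc zero) (suc (suc _)) = 0#
  E a b c t (suc (suc zero)) zero = b - c * t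
  E a b c t (suc (suc zero)) (suc zero) = t
  E a b c t (suc (suc zero)) (suc (suc zero)) = 1#
  E a b c t (suc (suc zero)) (suc (suc (suc zero))) = 0#
  E a b c t (suc (suc (suc zero))) zero = a
  E a b c t (suc (suc (suc zero))) (suc zero) = b
  E a b c t (suc (suc (suc zero))) (suc (suc zero)) = c
  E a b c t (suc (suc (suc zero))) (suc (suc (suc zero))) = 1#

  -- Subgroup generated by a predicate (all generators used below are
  -- invertible, so right inverses are the group inverses).

  Pred : Set₁
  Pred = Elem → Set

  data Gen (P : Pred) : Pred where
    gen  : ∀ {x} → P x → Gen P x
    unit : Gen P one
    mul  : ∀ {x y} → Gen P x → Gen P y → Gen P (x ∘ₑ y)
    inv  : ∀ {x y} → Gen P x → (x ∘ₑ y) ≈ one → Gen P y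
    resp : ∀ {x y} → Gen P x → x ≈ y → Gen P y

  -- z is the commutator [x,y] = x⁻¹y⁻¹xy, i.e. y x z = x y
  IsComm : Elem → Elem → Elem → Set
  IsComm x y z = ((y ∘ₑ x) ∘ₑ z) ≈ (x ∘ₑ y)

  -- lower central series: γ 1 = G, γ (i+1) = [γ i, G]   (γ 0 := G too)
  γ : Pred → ℕ → Pred
  γ G zero = G
  γ G (suc zero) = G
  γ G (suc (suc i)) =
    Gen (λ z → Σ Elem λ x → Σ Elem λ y → γ G (suc i) x × G y × IsComm x y z)

  Trivial : Pred → Set
  Trivial H = ∀ x → H x → x ≈ one

  NilpotencyClass : Pred → ℕ → Set
  NilpotencyClass G c =
    Trivial (γ G (suc c)) × (∀ d → Trivial (γ G (suc d)) → c ≤ d)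

  -- θ-exponent: k ∈ ℕ with k·1 = e (e ∈ F_p); the automorphism is g^k
  -- Construction B: n = p·l, g = frob l, θ = g^{tr(μ_C c)}, T = S₁
  GroupB : (l : ℕ) (s : ℕ → F) (μC : F) → Pred
  GroupB l s μC x =
    Σ F λ a → Σ F λ b → Σ F λ c → Σ ℕ λ k →
      (ι k ≡ tr (p ℕ.* l) (μC * c)) ×
      (x ≈ (E a b c (linPoly (p ℕ.* l) s c) , l ℕ.* k))

  -- Construction C: θ = g^{½Q(c) + tr(μ_B b)}, Q(x) = -tr(μ_B x S₁(x))
  QC : (n : ℕ) (s : ℕ → F) (μB : F) → F → F
  QC n s μB x = - tr n (μB * x * linPoly n s x)

  GroupC : (l : ℕ) (s : ℕ → F) (μB : F) → Pred
  GroupC l s μB x =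
    Σ F λ a → Σ F λ b → Σ F λ c → Σ ℕ λ k →
      (ι k ≡ ((ι 2) ⁻¹) * QC (p ℕ.* l) s μB c + tr (p ℕ.* l) (μB * b)) ×
      (x ≈ (E a b c (linPoly (p ℕ.* l) s c) , l ℕ.* k))

  -- Construction D (p = 3, n = 9l): g = frob l, g₁ = g³ = frob (3l)
  GensD : (l : ℕ) (s : ℕ → F) (μB μC α tC : F) → Pred
  GensD l s μB μC α tC x =
    (Σ F λ a → Σ F λ b → Σ F λ c → Σ ℕ λ k →
      (tr (9 ℕ.* l) (μC * c) ≡ 0#) ×
      (ι k ≡ ((ι 2) ⁻¹) * QC (9 ℕ.* l) s μB c
               + tr (9 ℕ.* l) (α * c + μB * b)) ×
      (x ≈ (E a b c (linPoly (9 ℕ.* l) s c) , (3 ℕ.* l) ℕ.* k)))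
    ⊎ (x ≈ (E 0# 0# tC (linPoly (9 ℕ.* l) s tC) , l))

  GroupD : (l : ℕ) (s : ℕ → F) (μB μC α tC : F) → Pred
  GroupD l s μB μC α tC = Gen (GensD l s μB μC α tC)

{-# OPTIONS --safe #-}
module Submission where

-- Write g for x ↦ x^(p^l), P for its order and D = g - 1. Since p divides the inner binomial
-- coefficients of P, expanding g^i = (1 + D)^i gives D^P = g^P - 1 = 0 and D^(P-1) = Tr, the
-- trace to the fixed field of g.
--
-- All three groups lie in the group of pairs (E(a,b,c,t), g^k). In its lower central series the
-- coordinates c and t of γ_{j+1} lie in the image of D^j, hence vanish from γ_{P+1} on; then b
-- dies after P more steps and a after another P, so γ_{3P+1} = 1.
--
-- For the lower bound take h with automorphism g and c-coordinate z. Commutation with h sends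
-- (E(a,b,0,0), 1) to (E(Da - 2z g(b), Db, 0, 0), 1), so starting from (0, b) the (2P-1)-fold
-- commutator has a-coordinate -2 Tr(b) Tr(z). In Constructions C and D the element has to satisfy
-- tr(μ_B b) = 0; then b = (y^p - y)/μ_B works for any y with Tr(y) outside F_p, which exists
-- because l > 1.
--
-- The exact class is found by search below 3P, triviality of γ_{d+1} being decidable through the
-- upper central series.

open import Defs
open import Level using (0ℓ)
open import Algebra.Bundles using (CommutativeRing; RawRing; Group)
open import Algebra.Structures using (IsCommutativeRing)
import Algebra.Solver.Ring
import Algebra.Properties.Group
import Algebra.Solver.Ring.AlmostCommutativeRing as ACR
import Algebra.Properties.Ring
import Algebra.Properties.CommutativeMonoid.Sum
open import Data.Nat as ℕ using (ℕ; zero; suc; _≤_; _<_; z≤n; s≤s; NonZero)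
import Data.Nat as N
import Data.Nat.Properties as ℕ
open import Data.Nat.GeneralisedArithmetic using (fold)
open import Data.Nat.Combinatorics using (_C_; nCk+nC[k+1]≡[n+1]C[k+1]; k>n⇒nCk≡0; nCn≡1; nC1≡n)
open import Data.Nat.DivMod using (m%n<n; m≡m%n+[m/n]*n)
open import Data.Nat.Divisibility using (_∣_; divides; ∣⇒≤; m∣m*n; m%n≡0⇒n∣m)
open import Data.Nat.Primality using (Prime; euclidsLemma; prime⇒nonZero; prime⇒nonTrivial; prime⇒irreducible; prime?; ¬prime[0])
open import Data.Fin as Fin using (Fin; zero; suc)
import Data.Fin.Properties as Fin
open import Data.Fin.Patterns using (0F; 1F; 2F; 3F)
open import Data.List using (List; _∷_; map; filter; cartesianProduct; allFin; upTo)
open import Data.List.Membership.Propositional using (_∈_)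
open import Data.List.Membership.Propositional.Properties using (∈-map⁺; ∈-map⁻; ∈-filter⁺; ∈-filter⁻; ∈-cartesianProduct⁺; ∈-allFin; ∈-upTo⁺)
open import Data.List.Relation.Unary.All as All using (All)
open import Data.List.Relation.Unary.Any using (here; there)
open import Data.Maybe using (Maybe; just; nothing)
open import Data.Product using (Σ; _×_; _,_; proj₁; proj₂)
open import Data.Sum using (inj₁; inj₂)
open import Data.Unit using (⊤; tt)
open import Function using (_∘_)
open import Function.Bundles using (_↔_; Inverse; mk↔ₛ′)
open import Function.Properties.Inverse using (↔⇒↣)
open import Relation.Binary.Bundles using (Setoid)
open import Relation.Binary.PropositionalEquality using (_≡_; _≢_; refl; sym; trans; cong; cong₂; subst; module ≡-Reasoning)
open import Relation.Nullary using (¬_; Dec; yes; no; ¬?; _×-dec_; contradiction)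
open import Relation.Nullary.Decidable as Dec using (from-yes)

-- Binomial coefficients

-- The product of two pairs contains cross terms: its b-coordinate involves c and t, its
-- a-coordinate involves b, c and t. A coordinate of a commutator with an element over g^k therefore
-- obeys the bare rule u ↦ (g^k - 1)u only once the coordinates before it are zero. This forces
-- three phases of P steps, each resting on the divisibility of g^k - 1 by D. The automorphism
-- components commute, so they are trivial from γ_2 on. The same cross terms give the lower bound.
-- The term z g(b) arises once from each of the two products that a commutator compares, hence the
-- factor 2 and the need for odd p. After P steps b is gone, but the last cross term -2z Tr(b)
-- survives; as g fixes Tr(b), the remaining P - 1 applications of D only turn z into Tr(z). For l =
-- 1 one would have tr(μ b) = μ Tr(b), so tr(μ b) = 0 and Tr(b) ≠ 0 would exclude each other.
-- Constructively, a least d with γ_{d+1} trivial has to be searched for. The terms γ are generated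
-- by existential predicates, whereas iterated commutators of the members of a finite list can be
-- tested.

absorption : ∀ n k → suc k ℕ.* (suc n C suc k) ≡ suc n ℕ.* (n C k)
absorption zero zero = refl
absorption zero (suc k) = trans (cong (suc (suc k) ℕ.*_) (k>n⇒nCk≡0 {1} {2 ℕ.+ k} (s≤s (s≤s z≤n)))) (trans (ℕ.*-zeroʳ (suc (suc k))) (sym (trans (ℕ.*-identityˡ _) (k>n⇒nCk≡0 {0} {suc k} (s≤s z≤n)))))
absorption (suc n) zero = trans (ℕ.*-identityˡ _) (trans (nC1≡n (suc (suc n))) (sym (ℕ.*-identityʳ (suc (suc n)))))
absorption (suc n) (suc k) = begin
  suc (suc k) ℕ.* (suc (suc n) C suc (suc k))
    ≡⟨ cong (suc (suc k) ℕ.*_) (nCk+nC[k+1]≡[n+1]C[k+1] (suc n) (suc k)) ⟨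
  suc (suc k) ℕ.* (x ℕ.+ y)
    ≡⟨ ℕ.*-distribˡ-+ (suc (suc k)) x y ⟩
  x ℕ.+ suc k ℕ.* x ℕ.+ suc (suc k) ℕ.* y
    ≡⟨ cong₂ (λ u v → x ℕ.+ u ℕ.+ v) (absorption n k) (absorption n (suc k)) ⟩
  x ℕ.+ suc n ℕ.* (n C k) ℕ.+ suc n ℕ.* (n C suc k)
    ≡⟨ ℕ.+-assoc x _ _ ⟩
  x ℕ.+ (suc n ℕ.* (n C k) ℕ.+ suc n ℕ.* (n C suc k))
    ≡⟨ cong (x ℕ.+_) (ℕ.*-distribˡ-+ (suc n) (n C k) (n C suc k)) ⟨
  x ℕ.+ suc n ℕ.* (n C k ℕ.+ n C suc k)
    ≡⟨ cong (λ u → x ℕ.+ suc n ℕ.* u) (nCk+nC[k+1]≡[n+1]C[k+1] n k) ⟩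
  x ℕ.+ suc n ℕ.* x ∎
  where
  open ≡-Reasoning
  x = suc n C suc k
  y = suc n C suc (suc k)

-- By `absorption`, p divides j times the coefficient; since 0 < j < p, Euclid's lemma leaves only
-- the coefficient.
prime∣pCj : ∀ {p} → Prime p → ∀ j → 0 < j → j < p → p ∣ p C j
prime∣pCj {suc n} pr (suc j) _ j<p with euclidsLemma (suc j) (suc n C suc j) pr (subst (suc n ∣_) (sym (absorption n j)) (m∣m*n (n C j)))
... | inj₁ p∣j = contradiction (∣⇒≤ p∣j) (ℕ.<⇒≱ j<p)
... | inj₂ p∣C = p∣C

-- Ring identities and a solver with integer coefficients

module RingFacts (K : FiniteField) (p : ℕ) where
  open FieldDefs K p public
  open IsCommutativeRing isCommutativeRing public
    using (+-assoc; +-comm; +-identityˡ; +-identityʳ; *-assoc; *-comm; *-identityˡ; *-identityʳ; distribˡ; distribʳ; zeroˡ; zeroʳ; -‿inverseˡ; -‿inverseʳ)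

  commutativeRing : CommutativeRing 0ℓ 0ℓ
  commutativeRing = record { isCommutativeRing = isCommutativeRing }

  open CommutativeRing commutativeRing using (ring; +-group)
  open Algebra.Properties.Ring ring public using (-‿distribˡ-*; -‿distribʳ-*; -0#≈0#)
  open import Algebra.Properties.Group +-group public using () renaming (∙-cancelˡ to +-cancelˡ; x∙y⁻¹≈ε⇒x≈y to x-y≡0⇒x≡y; x≈y⇒x∙y⁻¹≈ε to x≡y⇒x-y≡0)

  ι-+ : ∀ m n → ι (m ℕ.+ n) ≡ ι m + ι n
  ι-+ zero n = sym (+-identityˡ _)
  ι-+ (suc m) n = trans (cong (1# +_) (ι-+ m n)) (sym (+-assoc _ _ _))

  ι-* : ∀ m n → ι (m ℕ.* n) ≡ ι m * ι n
  ι-* zero n = sym (zeroˡ _)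
  ι-* (suc m) n = trans (ι-+ n (m ℕ.* n))
    (trans (cong₂ _+_ (sym (*-identityˡ (ι n))) (ι-* m n)) (sym (distribʳ (ι n) 1# (ι m))))

  ι-∣ : ι p ≡ 0# → ∀ {m} → p ∣ m → ι m ≡ 0#
  ι-∣ ιp≡0 (divides q refl) = trans (ι-* q p) (trans (cong (ι q *_) ιp≡0) (zeroʳ _))

  -- The ring solver needs coefficients with a decidable equality that computes;
  -- (m , n) stands for the integer m - n.
  module IntegerSolver where
    -- Removing common successors leaves one component 0, so a coefficient such as 1 - 1 becomes (0
    -- , 0) and evaluates to `0#` itself.
    reduce : ℕ → ℕ → ℕ × ℕ
    reduce (suc m) (suc n) = reduce m n
    reduce m n = m , n

    Coeff : RawRing 0ℓ 0ℓ
    Coeff = record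
      { Carrier = ℕ × ℕ
      ; _≈_ = _≡_
      ; _+_ = λ (m , n) (m′ , n′) → reduce (m ℕ.+ m′) (n ℕ.+ n′)
      ; _*_ = λ (m , n) (m′ , n′) → reduce (m ℕ.* m′ ℕ.+ n ℕ.* n′) (m ℕ.* n′ ℕ.+ n ℕ.* m′)
      ; -_ = λ (m , n) → n , m
      ; 0# = 0 , 0
      ; 1# = 1 , 0
      }

    -- The literals 0 and 1 evaluate definitionally to 0# and 1#.
    nat : ℕ → F
    nat zero = 0#
    nat (suc zero) = 1#
    nat (suc (suc n)) = 1# + nat (suc n)

    ⟦_⟧ : ℕ × ℕ → F
    ⟦ m , zero ⟧ = nat m
    ⟦ m , suc n ⟧ = nat m - nat (suc n)

    nat≡ι : ∀ n → nat n ≡ ι n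
    nat≡ι zero = refl
    nat≡ι (suc zero) = sym (+-identityʳ 1#)
    nat≡ι (suc (suc n)) = cong (1# +_) (nat≡ι (suc n))

    ⟦⟧≡ : ∀ m n → ⟦ m , n ⟧ ≡ ι m - ι n
    ⟦⟧≡ m zero = trans (nat≡ι m) (sym (trans (cong (ι m +_) -0#≈0#) (+-identityʳ _)))
    ⟦⟧≡ m (suc n) = cong₂ _-_ (nat≡ι m) (nat≡ι (suc n))

    open import Algebra.Properties.AbelianGroup (CommutativeRing.+-abelianGroup commutativeRing) using (⁻¹-∙-comm)
    open import Algebra.Properties.Group +-group using (⁻¹-anti-homo-//)
    open import Algebra.Properties.CommutativeSemigroup (CommutativeRing.+-commutativeSemigroup commutativeRing) using (interchange)
    open ≡-Reasoning

    ⟦reduce⟧ : ∀ m n → ⟦ reduce m n ⟧ ≡ ι m - ι n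
    ⟦reduce⟧ zero n = ⟦⟧≡ zero n
    ⟦reduce⟧ (suc m) zero = ⟦⟧≡ (suc m) zero
    ⟦reduce⟧ (suc m) (suc n) = begin
      ⟦ reduce m n ⟧ ≡⟨ ⟦reduce⟧ m n ⟩
      ι m - ι n ≡⟨ +-identityˡ _ ⟨
      0# + (ι m - ι n) ≡⟨ cong (_+ (ι m - ι n)) (-‿inverseʳ 1#) ⟨
      (1# - 1#) + (ι m - ι n) ≡⟨ interchange 1# (- 1#) (ι m) (- (ι n)) ⟩
      (1# + ι m) + (- 1# + - (ι n)) ≡⟨ cong ((1# + ι m) +_) (⁻¹-∙-comm 1# (ι n)) ⟩
      (1# + ι m) - (1# + ι n) ∎

    +-hom : ∀ x y → ⟦ RawRing._+_ Coeff x y ⟧ ≡ ⟦ x ⟧ + ⟦ y ⟧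
    +-hom (m , n) (m′ , n′) = begin
      ⟦ reduce (m ℕ.+ m′) (n ℕ.+ n′) ⟧ ≡⟨ ⟦reduce⟧ (m ℕ.+ m′) (n ℕ.+ n′) ⟩
      ι (m ℕ.+ m′) - ι (n ℕ.+ n′) ≡⟨ cong₂ _-_ (ι-+ m m′) (ι-+ n n′) ⟩
      (ι m + ι m′) - (ι n + ι n′) ≡⟨ cong ((ι m + ι m′) +_) (⁻¹-∙-comm (ι n) (ι n′)) ⟨
      (ι m + ι m′) + (- (ι n) + - (ι n′)) ≡⟨ interchange _ _ _ _ ⟩
      (ι m - ι n) + (ι m′ - ι n′) ≡⟨ cong₂ _+_ (⟦⟧≡ m n) (⟦⟧≡ m′ n′) ⟨
      ⟦ m , n ⟧ + ⟦ m′ , n′ ⟧ ∎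

    neg-hom : ∀ x → ⟦ RawRing.-_ Coeff x ⟧ ≡ - ⟦ x ⟧
    neg-hom (m , n) = begin
      ⟦ n , m ⟧ ≡⟨ ⟦⟧≡ n m ⟩
      ι n - ι m ≡⟨ ⁻¹-anti-homo-// (ι m) (ι n) ⟨
      - (ι m - ι n) ≡⟨ cong -_ (⟦⟧≡ m n) ⟨
      - ⟦ m , n ⟧ ∎

    *-hom : ∀ x y → ⟦ RawRing._*_ Coeff x y ⟧ ≡ ⟦ x ⟧ * ⟦ y ⟧
    *-hom (m , n) (m′ , n′) = begin
      ⟦ reduce (m ℕ.* m′ ℕ.+ n ℕ.* n′) (m ℕ.* n′ ℕ.+ n ℕ.* m′) ⟧
        ≡⟨ ⟦reduce⟧ (m ℕ.* m′ ℕ.+ n ℕ.* n′) (m ℕ.* n′ ℕ.+ n ℕ.* m′) ⟩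
      ι (m ℕ.* m′ ℕ.+ n ℕ.* n′) - ι (m ℕ.* n′ ℕ.+ n ℕ.* m′)
        ≡⟨ cong₂ _-_ (ι-+* m m′ n n′) (ι-+* m n′ n m′) ⟩
      (a * c + b * d) - (a * d + b * c) ≡⟨ cong ((a * c + b * d) +_) (⁻¹-∙-comm _ _) ⟨
      (a * c + b * d) + (- (a * d) + - (b * c)) ≡⟨ cong ((a * c + b * d) +_) (+-comm _ _) ⟩
      (a * c + b * d) + (- (b * c) + - (a * d)) ≡⟨ interchange _ _ _ _ ⟩
      (a * c - b * c) + (b * d - a * d) ≡⟨ cong₂ _+_ (expand a b c) (trans (sym (⁻¹-anti-homo-// (a * d) (b * d))) (cong -_ (expand a b d))) ⟩
      (a - b) * c - (a - b) * d ≡⟨ cong ((a - b) * c +_) (-‿distribʳ-* (a - b) d) ⟩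
      (a - b) * c + (a - b) * - d ≡⟨ distribˡ (a - b) c (- d) ⟨
      (a - b) * (c - d) ≡⟨ cong₂ _*_ (⟦⟧≡ m n) (⟦⟧≡ m′ n′) ⟨
      ⟦ m , n ⟧ * ⟦ m′ , n′ ⟧ ∎
      where
      a = ι m
      b = ι n
      c = ι m′
      d = ι n′
      ι-+* : ∀ i j k l → ι (i ℕ.* j ℕ.+ k ℕ.* l) ≡ ι i * ι j + ι k * ι l
      ι-+* i j k l = trans (ι-+ (i ℕ.* j) (k ℕ.* l)) (cong₂ _+_ (ι-* i j) (ι-* k l))
      expand : ∀ x y z → x * z - y * z ≡ (x - y) * z
      expand x y z = trans (cong (x * z +_) (-‿distribˡ-* y z)) (sym (distribʳ z x (- y)))

    -- Equality of differences is tested through cross sums in ℕ, so it does not depend on the pairs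
    -- being reduced.
    ⟦⟧-weaklyDecidable : ∀ x y → Maybe (⟦ x ⟧ ≡ ⟦ y ⟧)
    ⟦⟧-weaklyDecidable (m , n) (m′ , n′) with m ℕ.+ n′ ℕ.≟ m′ ℕ.+ n
    ... | no _ = nothing
    ... | yes eq = just (begin
      ⟦ m , n ⟧ ≡⟨ ⟦⟧≡ m n ⟩
      a - b ≡⟨ trans (cong (_- b) (sym (trans (+-assoc a d (- d)) (trans (cong (a +_) (-‿inverseʳ d)) (+-identityʳ a))))) refl ⟩
      (a + d - d) - b ≡⟨ cong (λ z → (z - d) - b) (trans (sym (ι-+ m n′)) (trans (cong ι eq) (ι-+ m′ n))) ⟩
      (c + b - d) - b ≡⟨ cong (_- b) (trans (+-assoc c b (- d)) (trans (cong (c +_) (+-comm b (- d))) (sym (+-assoc c (- d) b)))) ⟩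
      (c - d + b) - b ≡⟨ trans (+-assoc (c - d) b (- b)) (trans (cong ((c - d) +_) (-‿inverseʳ b)) (+-identityʳ _)) ⟩
      c - d ≡⟨ ⟦⟧≡ m′ n′ ⟨
      ⟦ m′ , n′ ⟧ ∎)
      where
      a = ι m
      b = ι n
      c = ι m′
      d = ι n′

    morphism : Coeff ACR.-Raw-AlmostCommutative⟶ ACR.fromCommutativeRing commutativeRing
    morphism = record
      { ⟦_⟧ = ⟦_⟧
      ; +-homo = +-hom
      ; *-homo = *-hom
      ; -‿homo = neg-hom
      ; 0-homo = refl
      ; 1-homo = refl
      }

  open Algebra.Solver.Ring IntegerSolver.Coeff (ACR.fromCommutativeRing commutativeRing) IntegerSolver.morphism IntegerSolver.⟦⟧-weaklyDecidable public
    using (solve; _:=_; _:+_; _:*_; _:-_; :-_; con; Polynomial)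

-- Finite fields: characteristic, the identity x^q = x, and counting roots

module FiniteFieldFacts (K : FiniteField) (p : ℕ) where
  open RingFacts K p public
  open CommutativeRing commutativeRing using (+-commutativeMonoid; *-commutativeMonoid)

  toFin : F → Fin size
  toFin = Inverse.to enum

  fromFin : Fin size → F
  fromFin = Inverse.from enum

  fromFin-toFin : ∀ x → fromFin (toFin x) ≡ x
  fromFin-toFin x = Inverse.inverseʳ enum refl

  toFin-fromFin : ∀ i → toFin (fromFin i) ≡ i
  toFin-fromFin i = Inverse.inverseˡ enum refl

  infix 4 _≟_
  _≟_ : (x y : F) → Dec (x ≡ y)
  _≟_ = Fin.inj⇒≟ (↔⇒↣ enum)

  all? : {P : F → Set} → (∀ x → Dec (P x)) → Dec (∀ x → P x)
  all? {P} P? = Dec.map′ (λ h x → subst P (fromFin-toFin x) (h (toFin x))) (λ h i → h (fromFin i)) (Fin.all? (λ i → P? (fromFin i)))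

  ¬all⇒∃ : (f : F → F) → ¬ (∀ x → f x ≡ 0#) → Σ F λ x → f x ≢ 0#
  ¬all⇒∃ f ¬0 with Fin.any? (λ i → ¬? (f (fromFin i) ≟ 0#))
  ... | yes (i , fi≢0) = fromFin i , fi≢0
  ... | no ∄ = contradiction (λ x → Dec.decidable-stable (f x ≟ 0#) (λ fx≢0 → ∄ (toFin x , (λ e → fx≢0 (trans (cong f (sym (fromFin-toFin x))) e))))) ¬0

  x*y≡0⇒y≡0 : ∀ {x y} → x ≢ 0# → x * y ≡ 0# → y ≡ 0#
  x*y≡0⇒y≡0 {x} {y} x≢0 xy≡0 = begin
    y ≡⟨ *-identityˡ y ⟨
    1# * y ≡⟨ cong (_* y) (inverseʳ x x≢0) ⟨
    x * x ⁻¹ * y ≡⟨ solve 3 (λ x i y → x :* i :* y := i :* (x :* y)) refl x (x ⁻¹) y ⟩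
    x ⁻¹ * (x * y) ≡⟨ cong (x ⁻¹ *_) xy≡0 ⟩
    x ⁻¹ * 0# ≡⟨ zeroʳ _ ⟩
    0# ∎
    where open ≡-Reasoning

  *-nonzero : ∀ {x y} → x ≢ 0# → y ≢ 0# → x * y ≢ 0#
  *-nonzero x≢0 y≢0 xy≡0 = y≢0 (x*y≡0⇒y≡0 x≢0 xy≡0)

  *-cancelˡ : ∀ {x y z} → x ≢ 0# → x * y ≡ x * z → y ≡ z
  *-cancelˡ {x} {y} {z} x≢0 eq = x-y≡0⇒x≡y y z (x*y≡0⇒y≡0 x≢0
    (trans (solve 3 (λ x y z → x :* (y :- z) := x :* y :- x :* z) refl x y z) (x≡y⇒x-y≡0 eq)))

  inverse-nonzero : ∀ {x} → x ≢ 0# → x ⁻¹ ≢ 0#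
  inverse-nonzero {x} x≢0 i≡0 = 0≢1 (trans (sym (zeroʳ x)) (trans (cong (x *_) (sym i≡0)) (inverseʳ x x≢0)))

  ^-nonzero : ∀ {x} n → x ≢ 0# → x ^ n ≢ 0#
  ^-nonzero zero x≢0 = 0≢1 ∘ sym
  ^-nonzero (suc n) x≢0 = *-nonzero x≢0 (^-nonzero n x≢0)

  ^-+ : ∀ x m n → x ^ (m ℕ.+ n) ≡ x ^ m * x ^ n
  ^-+ x zero n = sym (*-identityˡ _)
  ^-+ x (suc m) n = trans (cong (x *_) (^-+ x m n)) (sym (*-assoc _ _ _))

  ^-^ : ∀ x m n → x ^ (m ℕ.* n) ≡ (x ^ n) ^ m
  ^-^ x zero n = refl
  ^-^ x (suc m) n = trans (^-+ x n (m ℕ.* n)) (cong (x ^ n *_) (^-^ x m n))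

  ^-* : ∀ x y n → (x * y) ^ n ≡ x ^ n * y ^ n
  ^-* x y zero = sym (*-identityˡ _)
  ^-* x y (suc n) = trans (cong (x * y *_) (^-* x y n))
    (solve 4 (λ x y u v → x :* y :* (u :* v) := x :* u :* (y :* v)) refl x y (x ^ n) (y ^ n))

  1^n≡1 : ∀ n → 1# ^ n ≡ 1#
  1^n≡1 zero = refl
  1^n≡1 (suc n) = trans (*-identityˡ _) (1^n≡1 n)

  ι-^ : ∀ m n → ι (m ℕ.^ n) ≡ ι m ^ n
  ι-^ m zero = +-identityʳ 1#
  ι-^ m (suc n) = trans (ι-* m (m ℕ.^ n)) (cong (ι m *_) (ι-^ m n))

  bijection-permutation : (f f⁻ : F → F) → (∀ x → f (f⁻ x) ≡ x) → (∀ x → f⁻ (f x) ≡ x) → Fin size ↔ Fin size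
  bijection-permutation f f⁻ ff⁻ f⁻f = mk↔ₛ′ (λ i → toFin (f (fromFin i))) (λ i → toFin (f⁻ (fromFin i)))
    (λ i → trans (cong (toFin ∘ f) (fromFin-toFin _)) (trans (cong toFin (ff⁻ _)) (toFin-fromFin i)))
    (λ i → trans (cong (toFin ∘ f⁻) (fromFin-toFin _)) (trans (cong toFin (f⁻f _)) (toFin-fromFin i)))

  private
    module Sum = Algebra.Properties.CommutativeMonoid.Sum +-commutativeMonoid
    module Prod = Algebra.Properties.CommutativeMonoid.Sum *-commutativeMonoid

  sum-const : ∀ n x → Sum.sum {n} (λ _ → x) ≡ ι n * x
  sum-const zero x = sym (zeroˡ x)
  sum-const (suc n) x = trans (cong (x +_) (sum-const n x))
    (solve 2 (λ x m → x :+ m :* x := (con (1 , 0) :+ m) :* x) refl x (ι n))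

  prod-const : ∀ n x → Prod.sum {n} (λ _ → x) ≡ x ^ n
  prod-const zero x = refl
  prod-const (suc n) x = cong (x *_) (prod-const n x)

  prod-nonzero : ∀ n (f : Fin n → F) → (∀ i → f i ≢ 0#) → Prod.sum f ≢ 0#
  prod-nonzero zero f f≢0 = 0≢1 ∘ sym
  prod-nonzero (suc n) f f≢0 = *-nonzero (f≢0 zero) (prod-nonzero n (f ∘ suc) (f≢0 ∘ suc))

  prod-single : ∀ {n} (i : Fin n) (f : Fin n → F) → (∀ j → j ≢ i → f j ≡ 1#) → Prod.sum f ≡ f i
  prod-single {suc n} zero f f≡1 = trans (cong (f zero *_) (trans (Prod.sum-cong-≗ (λ j → f≡1 (suc j) (λ ())))
    (trans (prod-const n 1#) (1^n≡1 n)))) (*-identityʳ _)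
  prod-single {suc n} (suc i) f f≡1 = trans (cong₂ _*_ (f≡1 zero (λ ())) (prod-single i (f ∘ suc) (λ j j≢i → f≡1 (suc j) (λ { refl → j≢i refl })))) (*-identityˡ _)

  -- Translation by 1 permutes the field, so the sum of all elements equals itself plus ι size.
  ι-size : ι size ≡ 0#
  ι-size = sym (+-cancelˡ (Sum.sum fromFin) 0# (ι size) (begin
    Sum.sum fromFin + 0# ≡⟨ +-identityʳ _ ⟩
    Sum.sum fromFin ≡⟨ Sum.sum-permute fromFin π ⟩
    Sum.sum (λ i → fromFin (toFin (fromFin i + 1#))) ≡⟨ Sum.sum-cong-≗ (λ i → fromFin-toFin (fromFin i + 1#)) ⟩
    Sum.sum (λ i → fromFin i + 1#) ≡⟨ Sum.∑-distrib-+ fromFin (λ _ → 1#) ⟩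
    Sum.sum fromFin + Sum.sum {size} (λ _ → 1#) ≡⟨ cong (Sum.sum fromFin +_) (trans (sum-const size 1#) (*-identityʳ _)) ⟩
    Sum.sum fromFin + ι size ∎))
    where
    open ≡-Reasoning
    π = bijection-permutation (_+ 1#) (_- 1#)
      (solve 1 (λ x → x :- con (1 , 0) :+ con (1 , 0) := x) refl)
      (solve 1 (λ x → x :+ con (1 , 0) :- con (1 , 0) := x) refl)

  -- The n-th power of `ι p` is `ι size` = 0, and a field has no nonzero nilpotents.
  ι-char : ∀ n → size ≡ p ℕ.^ n → ι p ≡ 0#
  ι-char n size≡pⁿ = Dec.decidable-stable (ι p ≟ 0#) (λ ιp≢0 →
    ^-nonzero n ιp≢0 (trans (sym (ι-^ p n)) (trans (cong ι (sym size≡pⁿ)) ι-size)))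

  -- Multiplication by x permutes the nonzero elements; 0 is replaced by 1 in the products.
  fermat : ∀ x → x ^ size ≡ x
  fermat x with x ≟ 0#
  -- The element `toFin 0#` only witnesses that `size` is positive.
  ... | yes refl = zero-pow size (toFin 0#)
    where
    zero-pow : ∀ n → Fin n → 0# ^ n ≡ 0#
    zero-pow (suc n) _ = zeroˡ _
  ... | no x≢0 = begin
    x ^ size ≡⟨ prod-const size x ⟨
    Prod.sum {size} (λ _ → x) ≡⟨ Prod.sum-cong-≗ (λ i → sym (uv (fromFin i))) ⟩
    Prod.sum (λ i → u (fromFin i) * v (fromFin i)) ≡⟨ Prod.∑-distrib-+ (u ∘ fromFin) (v ∘ fromFin) ⟩
    Prod.sum (u ∘ fromFin) * Prod.sum (v ∘ fromFin) ≡⟨ cong₂ _*_ prod-u prod-v ⟩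
    1# * x ≡⟨ *-identityˡ x ⟩
    x ∎
    where
    open ≡-Reasoning
    -- `u y` is the factor by which `f` changes when y is replaced by x y. `v` supplies the factor x
    -- that `u` misses at 0, so the product of all `v` is x and x^q splits as 1 · x.
    f u v : F → F
    f y with y ≟ 0#
    ... | yes _ = 1#
    ... | no _ = y
    u y with y ≟ 0#
    ... | yes _ = 1#
    ... | no _ = x
    v y with y ≟ 0#
    ... | yes _ = x
    ... | no _ = 1#

    uv : ∀ y → u y * v y ≡ x
    uv y with y ≟ 0#
    ... | yes _ = *-identityˡ x
    ... | no _ = *-identityʳ x

    f≢0 : ∀ y → f y ≢ 0#
    f≢0 y with y ≟ 0#
    ... | yes _ = 0≢1 ∘ sym
    ... | no y≢0 = y≢0

    f[xy] : ∀ y → f (x * y) ≡ f y * u y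
    f[xy] y with y ≟ 0# | x * y ≟ 0#
    ... | yes _ | yes _ = sym (*-identityˡ _)
    ... | yes refl | no xy≢0 = contradiction (zeroʳ x) xy≢0
    ... | no y≢0 | yes xy≡0 = contradiction xy≡0 (*-nonzero x≢0 y≢0)
    ... | no _ | no _ = *-comm x y

    v≡1 : ∀ y → y ≢ 0# → v y ≡ 1#
    v≡1 y y≢0 with y ≟ 0#
    ... | yes y≡0 = contradiction y≡0 y≢0
    ... | no _ = refl

    v0 : ∀ y → y ≡ 0# → v y ≡ x
    v0 y y≡0 with y ≟ 0#
    ... | yes _ = refl
    ... | no y≢0 = contradiction y≡0 y≢0

    prod-v : Prod.sum (v ∘ fromFin) ≡ x
    prod-v = trans (prod-single (toFin 0#) (v ∘ fromFin) (λ j j≢ → v≡1 (fromFin j)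
      (λ e → j≢ (trans (sym (toFin-fromFin j)) (cong toFin e))))) (v0 _ (fromFin-toFin 0#))

    π = bijection-permutation (x *_) (x ⁻¹ *_)
      (λ y → trans (solve 3 (λ x i y → x :* (i :* y) := x :* i :* y) refl x (x ⁻¹) y) (trans (cong (_* y) (inverseʳ x x≢0)) (*-identityˡ y)))
      (λ y → trans (solve 3 (λ x i y → i :* (x :* y) := x :* i :* y) refl x (x ⁻¹) y) (trans (cong (_* y) (inverseʳ x x≢0)) (*-identityˡ y)))

    prod-u : Prod.sum (u ∘ fromFin) ≡ 1#
    prod-u = *-cancelˡ (prod-nonzero size (f ∘ fromFin) (λ i → f≢0 (fromFin i))) (sym (begin
      Prod.sum (f ∘ fromFin) * 1# ≡⟨ *-identityʳ _ ⟩
      Prod.sum (f ∘ fromFin) ≡⟨ Prod.sum-permute (f ∘ fromFin) π ⟩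
      Prod.sum (λ i → f (fromFin (toFin (x * fromFin i)))) ≡⟨ Prod.sum-cong-≗ (λ i → trans (cong f (fromFin-toFin _)) (f[xy] (fromFin i))) ⟩
      Prod.sum (λ i → f (fromFin i) * u (fromFin i)) ≡⟨ Prod.∑-distrib-+ (f ∘ fromFin) (u ∘ fromFin) ⟩
      Prod.sum (f ∘ fromFin) * Prod.sum (u ∘ fromFin) ∎))

  -- HasDegree a d f: f is a polynomial function of degree at most d whose coefficient of x^d is a
  -- (the nested pairs are its Horner form).
  HasDegree : F → ℕ → (F → F) → Set
  HasDegree a zero f = ∀ x → f x ≡ a
  HasDegree a (suc d) f = Σ (F → F) λ g → Σ F λ c → HasDegree a d g × (∀ x → f x ≡ x * g x + c)

  hasDegree-resp : ∀ {a d f g} → (∀ x → g x ≡ f x) → HasDegree a d f → HasDegree a d g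
  hasDegree-resp {d = zero} g≗f h x = trans (g≗f x) (h x)
  hasDegree-resp {d = suc d} g≗f (k , c , hk , e) = k , c , hk , λ x → trans (g≗f x) (e x)

  hasDegree-+ : ∀ {a b} d {f g} → HasDegree a d f → HasDegree b d g → HasDegree (a + b) d (λ x → f x + g x)
  hasDegree-+ zero hf hg x = cong₂ _+_ (hf x) (hg x)
  hasDegree-+ (suc d) (f′ , c , hf , ef) (g′ , c′ , hg , eg) =
    _ , c + c′ , hasDegree-+ d hf hg , λ x → trans (cong₂ _+_ (ef x) (eg x))
      (solve 5 (λ x f g c c′ → (x :* f :+ c) :+ (x :* g :+ c′) := x :* (f :+ g) :+ (c :+ c′)) refl x (f′ x) (g′ x) c c′)

  hasDegree-neg : ∀ {a} d {f} → HasDegree a d f → HasDegree (- a) d (λ x → - f x)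
  hasDegree-neg zero hf x = cong -_ (hf x)
  hasDegree-neg (suc d) (f′ , c , hf , ef) = _ , - c , hasDegree-neg d hf , λ x → trans (cong -_ (ef x))
    (solve 3 (λ x f c → :- (x :* f :+ c) := x :* (:- f) :+ (:- c)) refl x (f′ x) c)

  hasDegree-suc : ∀ {a} d {f} → HasDegree a d f → HasDegree 0# (suc d) f
  hasDegree-suc {a} zero hf = (λ _ → 0#) , a , (λ _ → refl) , λ x → trans (hf x) (sym (trans (cong (_+ a) (zeroʳ x)) (+-identityˡ a)))
  hasDegree-suc (suc d) (f′ , c , hf , ef) = f′ , c , hasDegree-suc d hf , ef

  hasDegree-< : ∀ {a d e f} → d ℕ.<′ e → HasDegree a d f → HasDegree 0# e f
  hasDegree-< {d = d} (ℕ.≤′-reflexive refl) hf = hasDegree-suc d hf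
  hasDegree-< (ℕ.≤′-step d<e) hf = hasDegree-suc _ (hasDegree-< d<e hf)

  hasDegree-^ : ∀ d → HasDegree 1# d (_^ d)
  hasDegree-^ zero x = refl
  hasDegree-^ (suc d) = (_^ d) , 0# , hasDegree-^ d , λ x → sym (+-identityʳ _)

  -- Synthetic division on the Horner form: the inner factor g is divided first, and its remainder
  -- g(r) becomes the constant coefficient of the quotient.
  divide-linear : ∀ {a} d {f} → HasDegree a (suc d) f → ∀ r → Σ (F → F) λ h → HasDegree a d h × (∀ x → f x ≡ (x - r) * h x + f r)
  divide-linear {a} zero {f} (g , c , hg , ef) r = (λ _ → a) , (λ _ → refl) , λ x → begin
    f x ≡⟨ trans (ef x) (cong (λ u → x * u + c) (hg x)) ⟩
    x * a + c ≡⟨ solve 4 (λ x r a c → x :* a :+ c := (x :- r) :* a :+ (r :* a :+ c)) refl x r a c ⟩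
    (x - r) * a + (r * a + c) ≡⟨ cong ((x - r) * a +_) (trans (ef r) (cong (λ u → r * u + c) (hg r))) ⟨
    (x - r) * a + f r ∎
    where open ≡-Reasoning
  divide-linear (suc d) {f} (g , c , hg , ef) r with divide-linear d hg r
  ... | k , hk , ek = (λ x → x * k x + g r) , (k , g r , hk , λ _ → refl) , λ x → begin
    f x ≡⟨ trans (ef x) (cong (λ u → x * u + c) (ek x)) ⟩
    x * ((x - r) * k x + g r) + c ≡⟨ solve 5 (λ x r k g c → x :* ((x :- r) :* k :+ g) :+ c := (x :- r) :* (x :* k :+ g) :+ (r :* g :+ c)) refl x r (k x) (g r) c ⟩
    (x - r) * (x * k x + g r) + (r * g r + c) ≡⟨ cong ((x - r) * (x * k x + g r) +_) (ef r) ⟨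
    (x - r) * (x * k x + g r) + f r ∎
    where open ≡-Reasoning

  -- Splitting off x - r₀ keeps the leading coefficient, lowers the degree and preserves the
  -- remaining roots, until the coefficient itself is the value at a root.
  too-many-roots : ∀ {a} d {f} → HasDegree a d f → (r : Fin (suc d) → F) → (∀ i j → r i ≡ r j → i ≡ j) → (∀ i → f (r i) ≡ 0#) → a ≡ 0#
  too-many-roots zero hf r inj root = trans (sym (hf _)) (root zero)
  too-many-roots (suc d) {f} hf r inj root with divide-linear d hf (r zero)
  ... | h , hh , e = too-many-roots d hh (r ∘ suc) (λ i j eq → Fin.suc-injective (inj (suc i) (suc j) eq))
    (λ i → x*y≡0⇒y≡0 (λ eq → contradiction (inj (suc i) zero (x-y≡0⇒x≡y _ _ eq)) (λ ()))
      (begin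
      (r (suc i) - r zero) * h (r (suc i)) ≡⟨ +-identityʳ _ ⟨
      (r (suc i) - r zero) * h (r (suc i)) + 0# ≡⟨ cong ((r (suc i) - r zero) * h (r (suc i)) +_) (root zero) ⟨
      (r (suc i) - r zero) * h (r (suc i)) + f (r zero) ≡⟨ e (r (suc i)) ⟨
      f (r (suc i)) ≡⟨ root (suc i) ⟩
      0# ∎))
    where open ≡-Reasoning

  -- Every nonvanishing statement about traces goes back to this: they are monic polynomial
  -- functions of degree below q.
  nonroot : ∀ {d f} → HasDegree 1# d f → d < size → Σ F λ x → f x ≢ 0#
  nonroot {d} {f} hf d<q = ¬all⇒∃ f (λ f≡0 → 0≢1 (sym (too-many-roots d hf (λ i → fromFin (Fin.inject≤ i d<q))
    (λ i j eq → Fin.inject≤-injective d<q d<q i j (trans (sym (toFin-fromFin _)) (trans (cong toFin eq) (toFin-fromFin _)))) (λ i → f≡0 _))))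

iterate : {A : Set} → (A → A) → ℕ → A → A
iterate f n x = fold x f n

-- Finite sums, and powers of 1 + D for an additive map D

module FiniteSums (K : FiniteField) (p : ℕ) where
  open FiniteFieldFacts K p public

  Σ<-cong : ∀ n {f g : ℕ → F} → (∀ i → i < n → f i ≡ g i) → Σ< n f ≡ Σ< n g
  Σ<-cong zero f≗g = refl
  Σ<-cong (suc n) f≗g = cong₂ _+_ (Σ<-cong n (λ i i<n → f≗g i (ℕ.m<n⇒m<1+n i<n))) (f≗g n ℕ.≤-refl)

  Σ<-distrib-+ : ∀ n (f g : ℕ → F) → Σ< n (λ i → f i + g i) ≡ Σ< n f + Σ< n g
  Σ<-distrib-+ zero f g = sym (+-identityʳ 0#)
  Σ<-distrib-+ (suc n) f g = trans (cong (_+ (f n + g n)) (Σ<-distrib-+ n f g))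
    (solve 4 (λ a b c d → a :+ b :+ (c :+ d) := a :+ c :+ (b :+ d)) refl (Σ< n f) (Σ< n g) (f n) (g n))

  Σ<-zero : ∀ n (f : ℕ → F) → (∀ i → i < n → f i ≡ 0#) → Σ< n f ≡ 0#
  Σ<-zero zero f f≡0 = refl
  Σ<-zero (suc n) f f≡0 = trans (cong₂ _+_ (Σ<-zero n f (λ i i<n → f≡0 i (ℕ.m<n⇒m<1+n i<n))) (f≡0 n ℕ.≤-refl)) (+-identityʳ 0#)

  Σ<-head : ∀ n (f : ℕ → F) → Σ< (suc n) f ≡ f 0 + Σ< n (f ∘ suc)
  Σ<-head zero f = +-comm 0# (f 0)
  Σ<-head (suc n) f = trans (cong (_+ f (suc n)) (Σ<-head n f)) (+-assoc _ _ _)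

  Σ<-append : ∀ m n (f : ℕ → F) → Σ< (m ℕ.+ n) f ≡ Σ< m f + Σ< n (λ j → f (m ℕ.+ j))
  Σ<-append m zero f = trans (cong (λ k → Σ< k f) (ℕ.+-identityʳ m)) (sym (+-identityʳ _))
  Σ<-append m (suc n) f = trans (cong (λ k → Σ< k f) (ℕ.+-suc m n)) (trans (cong (_+ f (m ℕ.+ n)) (Σ<-append m n f)) (+-assoc _ _ _))

  ι-pascal : ∀ m j y → ι (m C suc j) * y + ι (m C j) * y ≡ ι (suc m C suc j) * y
  ι-pascal m j y = begin
    ι (m C suc j) * y + ι (m C j) * y ≡⟨ solve 3 (λ u v y → u :* y :+ v :* y := (v :+ u) :* y) refl (ι (m C suc j)) (ι (m C j)) y ⟩
    (ι (m C j) + ι (m C suc j)) * y ≡⟨ cong (_* y) (ι-+ (m C j) (m C suc j)) ⟨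
    ι (m C j ℕ.+ m C suc j) * y ≡⟨ cong (λ c → ι c * y) (nCk+nC[k+1]≡[n+1]C[k+1] m j) ⟩
    ι (suc m C suc j) * y ∎
    where open ≡-Reasoning

  -- Kept general because D will be multiplication by a constant, a Frobenius power, the absolute
  -- trace, and g - 1.
  module Additive (D : F → F) (D-+ : ∀ x y → D (x + y) ≡ D x + D y) where
    D-0 : D 0# ≡ 0#
    D-0 = +-cancelˡ (D 0#) _ _ (trans (sym (D-+ 0# 0#)) (trans (cong D (+-identityʳ 0#)) (sym (+-identityʳ _))))

    D-neg : ∀ x → D (- x) ≡ - D x
    D-neg x = +-cancelˡ (D x) _ _ (trans (sym (D-+ x (- x))) (trans (cong D (-‿inverseʳ x)) (trans D-0 (sym (-‿inverseʳ (D x))))))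

    D-- : ∀ x y → D (x - y) ≡ D x - D y
    D-- x y = trans (D-+ x (- y)) (cong (D x +_) (D-neg y))

    D-Σ : ∀ n f → D (Σ< n f) ≡ Σ< n (D ∘ f)
    D-Σ zero f = D-0
    D-Σ (suc n) f = trans (D-+ _ _) (cong (_+ D (f n)) (D-Σ n f))

    D-ι : ∀ n x → D (ι n * x) ≡ ι n * D x
    D-ι zero x = trans (cong D (zeroˡ x)) (trans D-0 (sym (zeroˡ _)))
    D-ι (suc n) x = begin
      D ((1# + ι n) * x) ≡⟨ cong D (solve 2 (λ m x → (con (1 , 0) :+ m) :* x := x :+ m :* x) refl (ι n) x) ⟩
      D (x + ι n * x) ≡⟨ D-+ _ _ ⟩
      D x + D (ι n * x) ≡⟨ cong (D x +_) (D-ι n x) ⟩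
      D x + ι n * D x ≡⟨ solve 2 (λ m x → x :+ m :* x := (con (1 , 0) :+ m) :* x) refl (ι n) (D x) ⟩
      (1# + ι n) * D x ∎
      where open ≡-Reasoning

    iterate-+ : ∀ n x y → iterate D n (x + y) ≡ iterate D n x + iterate D n y
    iterate-+ zero x y = refl
    iterate-+ (suc n) x y = trans (cong D (iterate-+ n x y)) (D-+ _ _)

    module Shift (g : F → F) (g≗ : ∀ x → g x ≡ x + D x) where
      -- The binomial theorem for (1 + D)^m; Pascal's rule merges the expansion with its image under
      -- D.
      iterate-shift : ∀ m x → iterate g m x ≡ Σ< (suc m) (λ j → ι (m C j) * iterate D j x)
      iterate-shift zero x = solve 1 (λ x → x := con (0 , 0) :+ (con (1 , 0) :+ con (0 , 0)) :* x) refl x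
      iterate-shift (suc m) x = begin
        g (iterate g m x) ≡⟨ g≗ _ ⟩
        iterate g m x + D (iterate g m x) ≡⟨ cong₂ _+_ (iterate-shift m x) (trans (cong D (iterate-shift m x)) (D-Σ (suc m) _)) ⟩
        Σ< (suc m) (λ j → ι (m C j) * iterate D j x) + Σ< (suc m) (λ j → D (ι (m C j) * iterate D j x))
          ≡⟨ cong₂ _+_ top (Σ<-cong (suc m) (λ j _ → D-ι (m C j) (iterate D j x))) ⟩
        (a + Σ< (suc m) (λ j → ι (m C suc j) * iterate D (suc j) x)) + Σ< (suc m) (λ j → ι (m C j) * iterate D (suc j) x)
          ≡⟨ +-assoc _ _ _ ⟩
        a + (Σ< (suc m) (λ j → ι (m C suc j) * iterate D (suc j) x) + Σ< (suc m) (λ j → ι (m C j) * iterate D (suc j) x))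
          ≡⟨ cong (a +_) (trans (sym (Σ<-distrib-+ (suc m) _ _)) (Σ<-cong (suc m) (λ j _ → ι-pascal m j (iterate D (suc j) x)))) ⟩
        a + Σ< (suc m) (λ j → ι (suc m C suc j) * iterate D (suc j) x)
          ≡⟨ Σ<-head (suc m) (λ j → ι (suc m C j) * iterate D j x) ⟨
        Σ< (suc (suc m)) (λ j → ι (suc m C j) * iterate D j x) ∎
        where
        open ≡-Reasoning
        a = ι (m C 0) * x
        -- The extra term j = m + 1 has coefficient 0. With it, splitting off j = 0 leaves a sum
        -- over the same range as the image under D.
        top : Σ< (suc m) (λ j → ι (m C j) * iterate D j x) ≡ a + Σ< (suc m) (λ j → ι (m C suc j) * iterate D (suc j) x)
        top = begin
          Σ< (suc m) (λ j → ι (m C j) * iterate D j x) ≡⟨ +-identityʳ _ ⟨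
          Σ< (suc m) (λ j → ι (m C j) * iterate D j x) + 0#
            ≡⟨ cong (Σ< (suc m) (λ j → ι (m C j) * iterate D j x) +_) (trans (cong (λ c → ι c * iterate D (suc m) x) (k>n⇒nCk≡0 (ℕ.n<1+n m))) (zeroˡ _)) ⟨
          Σ< (suc (suc m)) (λ j → ι (m C j) * iterate D j x) ≡⟨ Σ<-head (suc m) (λ j → ι (m C j) * iterate D j x) ⟩
          a + Σ< (suc m) (λ j → ι (m C suc j) * iterate D (suc j) x) ∎

      -- Formally this is ((1 + D)^m - 1) / D; the summand g^m added in the induction step is
      -- absorbed by Pascal's rule.
      sum-shift : ∀ m x → Σ< m (λ i → iterate g i x) ≡ Σ< m (λ j → ι (m C suc j) * iterate D j x)
      sum-shift zero x = refl
      sum-shift (suc m) x = begin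
        Σ< m (λ i → iterate g i x) + iterate g m x ≡⟨ cong₂ _+_ (trans (sum-shift m x) (sym (trans (cong (Σ< m (λ j → ι (m C suc j) * iterate D j x) +_) last≡0) (+-identityʳ _)))) (iterate-shift m x) ⟩
        Σ< (suc m) (λ j → ι (m C suc j) * iterate D j x) + Σ< (suc m) (λ j → ι (m C j) * iterate D j x)
          ≡⟨ Σ<-distrib-+ (suc m) _ _ ⟨
        Σ< (suc m) (λ j → ι (m C suc j) * iterate D j x + ι (m C j) * iterate D j x) ≡⟨ Σ<-cong (suc m) (λ j _ → ι-pascal m j (iterate D j x)) ⟩
        Σ< (suc m) (λ j → ι (suc m C suc j) * iterate D j x) ∎
        where
        open ≡-Reasoning
        last≡0 : ι (m C suc m) * iterate D m x ≡ 0#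
        last≡0 = trans (cong (λ c → ι c * iterate D m x) (k>n⇒nCk≡0 (ℕ.n<1+n m))) (zeroˡ _)

      module _ (ιp≡0 : ι p ≡ 0#) (P′ : ℕ) (p∣PCj : ∀ j → 0 < j → j < suc P′ → p ∣ suc P′ C j) where
        iterate-shift-P : ∀ x → iterate g (suc P′) x ≡ x + iterate D (suc P′) x
        iterate-shift-P x = begin
          iterate g (suc P′) x ≡⟨ iterate-shift (suc P′) x ⟩
          Σ< (suc P′) (λ j → ι (suc P′ C j) * iterate D j x) + ι (suc P′ C suc P′) * iterate D (suc P′) x
            ≡⟨ cong₂ _+_ (Σ<-head P′ _) (cong (λ c → ι c * iterate D (suc P′) x) (nCn≡1 (suc P′))) ⟩
          (ι 1 * x + Σ< P′ (λ j → ι (suc P′ C suc j) * iterate D (suc j) x)) + ι 1 * iterate D (suc P′) x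
            ≡⟨ cong (λ z → (ι 1 * x + z) + ι 1 * iterate D (suc P′) x) (Σ<-zero P′ _ (λ j j<P′ →
                 trans (cong (_* iterate D (suc j) x) (ι-∣ ιp≡0 (p∣PCj (suc j) (s≤s z≤n) (s≤s j<P′)))) (zeroˡ _))) ⟩
          (ι 1 * x + 0#) + ι 1 * iterate D (suc P′) x
            ≡⟨ solve 2 (λ x y → ((con (1 , 0) :+ con (0 , 0)) :* x :+ con (0 , 0)) :+ (con (1 , 0) :+ con (0 , 0)) :* y := x :+ y) refl x (iterate D (suc P′) x) ⟩
          x + iterate D (suc P′) x ∎
          where open ≡-Reasoning

        sum-shift-P : ∀ x → Σ< (suc P′) (λ i → iterate g i x) ≡ iterate D P′ x
        sum-shift-P x = begin
          Σ< (suc P′) (λ i → iterate g i x) ≡⟨ sum-shift (suc P′) x ⟩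
          Σ< P′ (λ j → ι (suc P′ C suc j) * iterate D j x) + ι (suc P′ C suc P′) * iterate D P′ x
            ≡⟨ cong₂ _+_ (Σ<-zero P′ _ (λ j j<P′ →
                 trans (cong (_* iterate D j x) (ι-∣ ιp≡0 (p∣PCj (suc j) (s≤s z≤n) (s≤s j<P′)))) (zeroˡ _)))
               (cong (λ c → ι c * iterate D P′ x) (nCn≡1 (suc P′))) ⟩
          0# + ι 1 * iterate D P′ x ≡⟨ solve 1 (λ y → con (0 , 0) :+ (con (1 , 0) :+ con (0 , 0)) :* y := y) refl (iterate D P′ x) ⟩
          iterate D P′ x ∎
          where open ≡-Reasoning

-- Frobenius powers and the absolute trace

module Frobenius (K : FiniteField) (p : ℕ) (prime : Prime p) (n : ℕ) (size≡pⁿ : FiniteField.size K ≡ p ℕ.^ n) where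
  open FiniteSums K p public

  ιp≡0 : ι p ≡ 0#
  ιp≡0 = ι-char n size≡pⁿ

  p≡1+ : p ≡ suc (ℕ.pred p)
  p≡1+ = sym (ℕ.suc-pred p {{prime⇒nonZero prime}})

  -- An instance of the operator expansion: D is multiplication by x, g is multiplication by 1 + x,
  -- both iterated p times on 1.
  [1+x]^p : ∀ x → (1# + x) ^ p ≡ 1# + x ^ p
  [1+x]^p x = begin
    (1# + x) ^ p ≡⟨ iterate-* (1# + x) p ⟨
    iterate ((1# + x) *_) p 1# ≡⟨ cong (λ m → iterate ((1# + x) *_) m 1#) p≡1+ ⟩
    iterate ((1# + x) *_) (suc (ℕ.pred p)) 1# ≡⟨ Shift.iterate-shift-P ((1# + x) *_)
      (λ y → solve 2 (λ x y → (con (1 , 0) :+ x) :* y := y :+ x :* y) refl x y) ιp≡0 (ℕ.pred p)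
      (subst (λ m → ∀ j → 0 < j → j < m → p ∣ m C j) p≡1+ (prime∣pCj prime)) 1# ⟩
    1# + iterate (x *_) (suc (ℕ.pred p)) 1# ≡⟨ cong (λ m → 1# + iterate (x *_) m 1#) p≡1+ ⟨
    1# + iterate (x *_) p 1# ≡⟨ cong (1# +_) (iterate-* x p) ⟩
    1# + x ^ p ∎
    where
    open ≡-Reasoning
    open Additive (x *_) (distribˡ x)
    iterate-* : ∀ c m → iterate (c *_) m 1# ≡ c ^ m
    iterate-* c zero = refl
    iterate-* c (suc m) = cong (c *_) (iterate-* c m)

  -- For x ≠ 0, factoring out x reduces the sum to 1 + y/x.
  ^p-+ : ∀ x y → (x + y) ^ p ≡ x ^ p + y ^ p
  ^p-+ x y with x ≟ 0#
  ... | yes refl = trans (cong (_^ p) (+-identityˡ y)) (sym (trans (cong (_+ y ^ p) 0^p) (+-identityˡ _)))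
    where
    0^p : 0# ^ p ≡ 0#
    0^p = trans (cong (0# ^_) p≡1+) (zeroˡ _)
  ... | no x≢0 = begin
    (x + y) ^ p ≡⟨ cong (_^ p) (solve 2 (λ x y → x :+ y := x :* con (1 , 0) :+ con (1 , 0) :* y) refl x y) ⟩
    (x * 1# + 1# * y) ^ p ≡⟨ cong (λ u → (x * 1# + u * y) ^ p) (inverseʳ x x≢0) ⟨
    (x * 1# + x * x ⁻¹ * y) ^ p ≡⟨ cong (_^ p) (solve 3 (λ x i y → x :* con (1 , 0) :+ x :* i :* y := x :* (con (1 , 0) :+ i :* y)) refl x (x ⁻¹) y) ⟩
    (x * (1# + x ⁻¹ * y)) ^ p ≡⟨ ^-* x (1# + x ⁻¹ * y) p ⟩
    x ^ p * (1# + x ⁻¹ * y) ^ p ≡⟨ cong (x ^ p *_) ([1+x]^p (x ⁻¹ * y)) ⟩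
    x ^ p * (1# + (x ⁻¹ * y) ^ p) ≡⟨ solve 2 (λ x y → x :* (con (1 , 0) :+ y) := x :+ x :* y) refl (x ^ p) ((x ⁻¹ * y) ^ p) ⟩
    x ^ p + x ^ p * (x ⁻¹ * y) ^ p ≡⟨ cong (x ^ p +_) (^-* x (x ⁻¹ * y) p) ⟨
    x ^ p + (x * (x ⁻¹ * y)) ^ p ≡⟨ cong (λ u → x ^ p + u ^ p) (trans (sym (*-assoc x (x ⁻¹) y)) (trans (cong (_* y) (inverseʳ x x≢0)) (*-identityˡ y))) ⟩
    x ^ p + y ^ p ∎
    where open ≡-Reasoning

  frob-+ : ∀ k x y → frob k (x + y) ≡ frob k x + frob k y
  frob-+ zero x y = solve 2 (λ x y → (x :+ y) :* con (1 , 0) := x :* con (1 , 0) :+ y :* con (1 , 0)) refl x y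
  frob-+ (suc k) x y = begin
    (x + y) ^ (p ℕ.* p ℕ.^ k) ≡⟨ ^-^ (x + y) p (p ℕ.^ k) ⟩
    frob k (x + y) ^ p ≡⟨ cong (_^ p) (frob-+ k x y) ⟩
    (frob k x + frob k y) ^ p ≡⟨ ^p-+ _ _ ⟩
    frob k x ^ p + frob k y ^ p ≡⟨ cong₂ _+_ (^-^ x p (p ℕ.^ k)) (^-^ y p (p ℕ.^ k)) ⟨
    x ^ (p ℕ.* p ℕ.^ k) + y ^ (p ℕ.* p ℕ.^ k) ∎
    where open ≡-Reasoning

  frob-* : ∀ k x y → frob k (x * y) ≡ frob k x * frob k y
  frob-* k x y = ^-* x y (p ℕ.^ k)

  module _ (k : ℕ) where
    open Additive (frob k) (frob-+ k) public using ()
      renaming (D-0 to frob-0; D-neg to frob-neg; D-- to frob--; D-Σ to frob-Σ; D-ι to frob-ι)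

  frob-1# : ∀ k → frob k 1# ≡ 1#
  frob-1# k = 1^n≡1 (p ℕ.^ k)

  frob-zero : ∀ x → frob 0 x ≡ x
  frob-zero x = *-identityʳ x

  frob-frob : ∀ j k x → frob j (frob k x) ≡ frob (j ℕ.+ k) x
  frob-frob j k x = trans (sym (^-^ x (p ℕ.^ j) (p ℕ.^ k))) (cong (x ^_) (sym (ℕ.^-distribˡ-+-* p j k)))

  frob-comm : ∀ j k x → frob j (frob k x) ≡ frob k (frob j x)
  frob-comm j k x = trans (frob-frob j k x) (trans (cong (λ i → frob i x) (ℕ.+-comm j k)) (sym (frob-frob k j x)))

  frob-n : ∀ x → frob n x ≡ x
  frob-n x = trans (cong (x ^_) (sym size≡pⁿ)) (fermat x)

  frob-n* : ∀ j x → frob (n ℕ.* j) x ≡ x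
  frob-n* zero x = trans (cong (λ k → frob k x) (ℕ.*-zeroʳ n)) (frob-zero x)
  frob-n* (suc j) x = trans (cong (λ k → frob k x) (ℕ.*-suc n j)) (trans (sym (frob-frob n (n ℕ.* j) x)) (trans (frob-n _) (frob-n* j x)))

  InSub-inverse : ∀ {k x} → x ≢ 0# → InSub k x → InSub k (x ⁻¹)
  InSub-inverse {k} {x} x≢0 fx≡x = *-cancelˡ x≢0 (begin
    x * frob k (x ⁻¹) ≡⟨ cong (_* frob k (x ⁻¹)) fx≡x ⟨
    frob k x * frob k (x ⁻¹) ≡⟨ frob-* k x (x ⁻¹) ⟨
    frob k (x * x ⁻¹) ≡⟨ cong (frob k) (inverseʳ x x≢0) ⟩
    frob k 1# ≡⟨ frob-1# k ⟩
    1# ≡⟨ inverseʳ x x≢0 ⟨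
    x * x ⁻¹ ∎)
    where open ≡-Reasoning

  InSub-* : ∀ {k x y} → InSub k x → InSub k y → InSub k (x * y)
  InSub-* {k} {x} {y} fx fy = trans (frob-* k x y) (cong₂ _*_ fx fy)

  InSub-neg : ∀ {k x} → InSub k x → InSub k (- x)
  InSub-neg {k} {x} fx = trans (frob-neg k x) (cong -_ fx)

  InSub-- : ∀ {k x y} → InSub k x → InSub k y → InSub k (x - y)
  InSub-- {k} {x} {y} fx fy = trans (frob-- k x y) (cong₂ _-_ fx fy)

  InSub-ι : ∀ k m → InSub k (ι m)
  InSub-ι k m = begin
    frob k (ι m) ≡⟨ cong (frob k) (*-identityʳ (ι m)) ⟨
    frob k (ι m * 1#) ≡⟨ frob-ι k m 1# ⟩
    ι m * frob k 1# ≡⟨ cong (ι m *_) (frob-1# k) ⟩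
    ι m * 1# ≡⟨ *-identityʳ (ι m) ⟩
    ι m ∎
    where open ≡-Reasoning

  InSub-multiple : ∀ {k x} → InSub k x → ∀ i → InSub (k ℕ.* i) x
  InSub-multiple {k} {x} fx zero = trans (cong (λ m → frob m x) (ℕ.*-zeroʳ k)) (frob-zero x)
  InSub-multiple {k} {x} fx (suc i) = trans (cong (λ m → frob m x) (ℕ.*-suc k i)) (trans (sym (frob-frob k (k ℕ.* i) x)) (trans (cong (frob k) (InSub-multiple {k} fx i)) fx))

  -- An even prime is 2; an odd p is 1 plus a multiple of 2, so a vanishing 2 would turn `ι p` = 0
  -- into 1 = 0.
  ι2≢0 : p ≢ 2 → ι 2 ≢ 0#
  ι2≢0 p≢2 ι2≡0 with p ℕ.% 2 in eq | m%n<n p 2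
  ... | 0 | _ with prime⇒irreducible prime (m%n≡0⇒n∣m p 2 eq)
  ...   | inj₂ 2≡p = p≢2 (sym 2≡p)
  ι2≢0 p≢2 ι2≡0 | 1 | _ = 0≢1 (begin
    0# ≡⟨ ιp≡0 ⟨
    ι p ≡⟨ cong ι (m≡m%n+[m/n]*n p 2) ⟩
    ι (p ℕ.% 2 ℕ.+ p ℕ./ 2 ℕ.* 2) ≡⟨ cong (λ r → ι (r ℕ.+ p ℕ./ 2 ℕ.* 2)) eq ⟩
    1# + ι (p ℕ./ 2 ℕ.* 2) ≡⟨ cong (1# +_) (trans (ι-* (p ℕ./ 2) 2) (trans (cong (ι (p ℕ./ 2) *_) ι2≡0) (zeroʳ _))) ⟩
    1# + 0# ≡⟨ +-identityʳ 1# ⟩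
    1# ∎)
    where open ≡-Reasoning
  ι2≢0 p≢2 ι2≡0 | suc (suc _) | s≤s (s≤s ())

  1<p : 1 < p
  1<p = ℕ.nonTrivial⇒n>1 p {{prime⇒nonTrivial prime}}

  -- The exponents increase strictly, so the last Frobenius power alone determines the leading
  -- coefficient. It serves the absolute trace (e i = i), the relative trace (l · i) and its p-th
  -- power (1 + l · i).
  hasDegree-Σ-frob : (e : ℕ → ℕ) → (∀ i → e i < e (suc i)) → ∀ m → HasDegree 1# (p ℕ.^ e m) (λ x → Σ< (suc m) (λ i → frob (e i) x))
  hasDegree-Σ-frob e e< zero = hasDegree-resp {d = p ℕ.^ e 0} (λ x → +-identityˡ _) (hasDegree-^ (p ℕ.^ e 0))
  hasDegree-Σ-frob e e< (suc m) = subst (λ a → HasDegree a (p ℕ.^ e (suc m)) (λ x → Σ< (suc (suc m)) (λ i → frob (e i) x))) (+-identityˡ 1#)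
    (hasDegree-+ (p ℕ.^ e (suc m))
      (hasDegree-< (ℕ.<⇒<′ (ℕ.^-monoʳ-< p 1<p (e< m))) (hasDegree-Σ-frob e e< m))
      (hasDegree-^ (p ℕ.^ e (suc m))))

  tr-+ : ∀ x y → tr n (x + y) ≡ tr n x + tr n y
  tr-+ x y = trans (Σ<-cong n (λ i _ → frob-+ i x y)) (Σ<-distrib-+ n (λ i → frob i x) (λ i → frob i y))

  open Additive (tr n) tr-+ public using () renaming (D-0 to tr-0; D-- to tr--)

  -- Raising to the p-th power shifts the summands by one: x leaves at the start and its n-th
  -- Frobenius image, again x, enters at the end.
  tr-frob : ∀ x → tr n (frob 1 x) ≡ tr n x
  tr-frob x = +-cancelˡ (frob 0 x) _ _ (begin
    frob 0 x + Σ< n (λ i → frob i (frob 1 x)) ≡⟨ cong (frob 0 x +_) (Σ<-cong n (λ i _ → trans (frob-frob i 1 x) (cong (λ k → frob k x) (ℕ.+-comm i 1)))) ⟩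
    frob 0 x + Σ< n (λ i → frob (suc i) x) ≡⟨ Σ<-head n (λ i → frob i x) ⟨
    tr n x + frob n x ≡⟨ cong (tr n x +_) (trans (frob-n x) (sym (frob-zero x))) ⟩
    tr n x + frob 0 x ≡⟨ +-comm _ _ ⟩
    frob 0 x + tr n x ∎)
    where open ≡-Reasoning

  tr-InSub : ∀ x → InSub 1 (tr n x)
  tr-InSub x = trans (frob-Σ 1 n (λ i → frob i x)) (trans (Σ<-cong n (λ i _ → frob-comm 1 i x)) (tr-frob x))

  tr-* : ∀ {c} → InSub 1 c → ∀ x → tr n (c * x) ≡ c * tr n x
  tr-* {c} fc x = trans (Σ<-cong n (λ i _ → trans (frob-* i c x) (cong (_* frob i x)
      (trans (cong (λ k → frob k c) (sym (ℕ.*-identityˡ i))) (InSub-multiple {1} fc i)))))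
    (sym (Additive.D-Σ (c *_) (distribˡ c) n (λ i → frob i x)))

  ∃tr≢0 : 0 < n → Σ F λ x → tr n x ≢ 0#
  ∃tr≢0 0<n = subst (λ k → Σ F λ x → tr k x ≢ 0#) (sym n≡)
    (nonroot (hasDegree-Σ-frob (λ i → i) ℕ.n<1+n m) (subst (p ℕ.^ m <_) (sym (trans size≡pⁿ (cong (p ℕ.^_) n≡))) (ℕ.^-monoʳ-< p 1<p (ℕ.n<1+n m))))
    where
    m = ℕ.pred n
    n≡ : n ≡ suc m
    n≡ = sym (ℕ.suc-pred n {{ℕ.>-nonZero 0<n}})

  -- Scale some z of trace τ ≠ 0 by e / τ, which lies in F_p and passes through the trace, and
  -- divide by μ.
  tr-surjective : 0 < n → ∀ {μ e} → μ ≢ 0# → InSub 1 e → Σ F λ y → tr n (μ * y) ≡ e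
  tr-surjective 0<n {μ} {e} μ≢0 fe with ∃tr≢0 0<n
  ... | z , τ≢0 = μ ⁻¹ * (e * τ ⁻¹ * z) , (begin
    tr n (μ * (μ ⁻¹ * (e * τ ⁻¹ * z))) ≡⟨ cong (tr n) (trans (sym (*-assoc _ _ _)) (trans (cong (_* (e * τ ⁻¹ * z)) (inverseʳ μ μ≢0)) (*-identityˡ _))) ⟩
    tr n (e * τ ⁻¹ * z) ≡⟨ tr-* (InSub-* {1} fe (InSub-inverse {1} τ≢0 (tr-InSub z))) z ⟩
    e * τ ⁻¹ * τ ≡⟨ solve 3 (λ e i τ → e :* i :* τ := e :* (τ :* i)) refl e (τ ⁻¹) τ ⟩
    e * (τ * τ ⁻¹) ≡⟨ cong (e *_) (inverseʳ τ τ≢0) ⟩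
    e * 1# ≡⟨ *-identityʳ e ⟩
    e ∎)
    where
    open ≡-Reasoning
    τ = tr n z

-- The automorphism g, the operator D = g - 1 and the relative trace

module Twist (K : FiniteField) (p : ℕ) (prime : Prime p) (P′ l : ℕ)
  (size≡ : FiniteField.size K ≡ p ℕ.^ (suc P′ ℕ.* l))
  (p∣PCj : ∀ j → 0 < j → j < suc P′ → p ∣ suc P′ C j) where

  P n : ℕ
  P = suc P′
  n = P ℕ.* l

  open Frobenius K p prime n size≡ public

  g D : F → F
  g = frob l
  D x = g x - x

  g≡1+D : ∀ x → g x ≡ x + D x
  g≡1+D x = solve 2 (λ x y → y := x :+ (y :- x)) refl x (g x)

  D-+ : ∀ x y → D (x + y) ≡ D x + D y
  D-+ x y = trans (cong (_- (x + y)) (frob-+ l x y))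
    (solve 4 (λ x y a b → (a :+ b) :- (x :+ y) := (a :- x) :+ (b :- y)) refl x y (g x) (g y))

  open Additive D D-+ public using (D-0; D-neg; iterate-+)
  private module S = Additive.Shift D D-+ g g≡1+D

  D-frob : ∀ k x → frob k (D x) ≡ D (frob k x)
  D-frob k x = trans (frob-- k (g x) x) (cong (_- frob k x) (frob-comm k l x))

  iterate-D-frob : ∀ j k x → frob k (iterate D j x) ≡ iterate D j (frob k x)
  iterate-D-frob zero k x = refl
  iterate-D-frob (suc j) k x = trans (D-frob k _) (cong D (iterate-D-frob j k x))

  iterate-D-0 : ∀ j → iterate D j 0# ≡ 0#
  iterate-D-0 zero = refl
  iterate-D-0 (suc j) = trans (cong D (iterate-D-0 j)) D-0

  iterate-D-neg : ∀ j x → iterate D j (- x) ≡ - iterate D j x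
  iterate-D-neg zero x = refl
  iterate-D-neg (suc j) x = trans (cong D (iterate-D-neg j x)) (D-neg _)

  iterate-D-D : ∀ j x → iterate D j (D x) ≡ iterate D (suc j) x
  iterate-D-D zero x = refl
  iterate-D-D (suc j) x = cong D (iterate-D-D j x)

  D-* : ∀ {c} → InSub l c → ∀ x → D (c * x) ≡ c * D x
  D-* {c} fc x = trans (cong (_- c * x) (trans (frob-* l c x) (cong (_* g x) fc)))
    (solve 3 (λ c y x → c :* y :- c :* x := c :* (y :- x)) refl c (g x) x)

  iterate-D-* : ∀ j {c} → InSub l c → ∀ x → iterate D j (c * x) ≡ c * iterate D j x
  iterate-D-* zero fc x = refl
  iterate-D-* (suc j) fc x = trans (cong D (iterate-D-* j fc x)) (D-* fc _)

  iterate-g : ∀ i x → iterate g i x ≡ frob (l ℕ.* i) x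
  iterate-g zero x = sym (trans (cong (λ k → frob k x) (ℕ.*-zeroʳ l)) (frob-zero x))
  iterate-g (suc i) x = trans (cong g (iterate-g i x)) (trans (frob-frob l (l ℕ.* i) x) (cong (λ k → frob k x) (sym (ℕ.*-suc l i))))

  frob-lP : ∀ j x → frob (l ℕ.* (P ℕ.* j)) x ≡ x
  frob-lP j x = trans (cong (λ k → frob k x) (trans (sym (ℕ.*-assoc l P j)) (cong (ℕ._* j) (ℕ.*-comm l P)))) (frob-n* j x)

  D^P≡0 : ∀ x → iterate D P x ≡ 0#
  D^P≡0 x = +-cancelˡ x _ _ (begin
    x + iterate D P x ≡⟨ S.iterate-shift-P ιp≡0 P′ p∣PCj x ⟨
    iterate g P x ≡⟨ iterate-g P x ⟩
    frob (l ℕ.* P) x ≡⟨ cong (λ k → frob (l ℕ.* k) x) (ℕ.*-identityʳ P) ⟨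
    frob (l ℕ.* (P ℕ.* 1)) x ≡⟨ frob-lP 1 x ⟩
    x ≡⟨ +-identityʳ x ⟨
    x + 0# ∎)
    where open ≡-Reasoning

  -- The relative trace to the subfield fixed by g.
  Tr : F → F
  Tr = iterate D P′

  Tr≡Σ : ∀ x → Tr x ≡ Σ< P (λ i → frob (l ℕ.* i) x)
  Tr≡Σ x = trans (sym (S.sum-shift-P ιp≡0 P′ p∣PCj x)) (Σ<-cong P (λ i _ → iterate-g i x))

  -- D applied to `Tr x` is D^P x = 0, which says that g fixes `Tr x`.
  Tr-InSub : ∀ x → InSub l (Tr x)
  Tr-InSub x = x-y≡0⇒x≡y _ _ (D^P≡0 x)

  -- Transitivity of the trace: each exponent below P · l is l · i + j with i < P and j < l.
  tr≡Σ-Tr : ∀ x → tr n x ≡ Σ< l (λ j → frob j (Tr x))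
  tr≡Σ-Tr x = trans (regroup P) (Σ<-cong l (λ j _ → cong (frob j) (sym (Tr≡Σ x))))
    where
    open ≡-Reasoning
    partial : ℕ → F
    partial m = Σ< m (λ i → frob (l ℕ.* i) x)
    regroup : ∀ m → Σ< (m ℕ.* l) (λ i → frob i x) ≡ Σ< l (λ j → frob j (partial m))
    regroup zero = sym (Σ<-zero l _ (λ j _ → frob-0 j))
    regroup (suc m) = begin
      Σ< (l ℕ.+ m ℕ.* l) (λ i → frob i x) ≡⟨ cong (λ k → Σ< k (λ i → frob i x)) (ℕ.+-comm l (m ℕ.* l)) ⟩
      Σ< (m ℕ.* l ℕ.+ l) (λ i → frob i x) ≡⟨ Σ<-append (m ℕ.* l) l (λ i → frob i x) ⟩
      Σ< (m ℕ.* l) (λ i → frob i x) + Σ< l (λ j → frob (m ℕ.* l ℕ.+ j) x)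
        ≡⟨ cong₂ _+_ (regroup m) (Σ<-cong l (λ j _ → trans (cong (λ k → frob k x) (trans (ℕ.+-comm (m ℕ.* l) j) (cong (j ℕ.+_) (ℕ.*-comm m l)))) (sym (frob-frob j (l ℕ.* m) x)))) ⟩
      Σ< l (λ j → frob j (partial m)) + Σ< l (λ j → frob j (frob (l ℕ.* m) x)) ≡⟨ Σ<-distrib-+ l _ _ ⟨
      Σ< l (λ j → frob j (partial m) + frob j (frob (l ℕ.* m) x)) ≡⟨ Σ<-cong l (λ j _ → sym (frob-+ j _ _)) ⟩
      Σ< l (λ j → frob j (partial (suc m))) ∎

  -- The absolute trace of μ z factors through Tr(μ z) = μ Tr(z), because g fixes μ.
  Tr≢0 : ∀ {μ z} → InSub l μ → tr n (μ * z) ≢ 0# → Tr z ≢ 0#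
  Tr≢0 {μ} {z} fμ tr≢0 Tr≡0 = tr≢0 (begin
    tr n (μ * z) ≡⟨ tr≡Σ-Tr (μ * z) ⟩
    Σ< l (λ j → frob j (Tr (μ * z))) ≡⟨ Σ<-zero l _ (λ j _ → trans (cong (frob j) (trans (iterate-D-* P′ fμ z) (trans (cong (μ *_) Tr≡0) (zeroʳ μ)))) (frob-0 j)) ⟩
    0# ∎)
    where open ≡-Reasoning

  0<n : 1 < l → 0 < n
  0<n 1<l = ℕ.≤-trans (ℕ.<⇒≤ 1<l) (ℕ.m≤m+n l (P′ ℕ.* l))

  ∃Tr≢0 : 1 < l → Σ F λ z → Tr z ≢ 0#
  ∃Tr≢0 1<l with ∃tr≢0 (0<n 1<l)
  ... | z , trz≢0 = z , Tr≢0 (frob-1# l) (λ eq → trz≢0 (trans (cong (tr n) (sym (*-identityˡ z))) eq))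

  -- (Tr y)^p - Tr y has degree p^(l P′ + 1) < p^n because l > 1, so Tr takes values outside F_p.
  ∃Tr∉Fₚ : 1 < l → Σ F λ y → frob 1 (Tr y) - Tr y ≢ 0#
  ∃Tr∉Fₚ 1<l = nonroot {d} {λ y → frob 1 (Tr y) - Tr y} (hasDegree-resp {1#} {d} {λ y → upper y + - lower y} pointwise degree) bound
    where
    open ≡-Reasoning
    d : ℕ
    d = p ℕ.^ suc (l ℕ.* P′)
    lower upper : F → F
    lower y = Σ< P (λ i → frob (l ℕ.* i) y)
    upper y = Σ< P (λ i → frob (suc (l ℕ.* i)) y)
    incr : ∀ i → l ℕ.* i < l ℕ.* suc i
    incr i = ℕ.*-monoʳ-< l {{ℕ.>-nonZero (ℕ.<⇒≤ 1<l)}} (ℕ.n<1+n i)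
    degree : HasDegree 1# d (λ y → upper y + - lower y)
    degree = subst (λ a → HasDegree a d (λ y → upper y + - lower y)) (+-identityʳ 1#)
      (hasDegree-+ {1#} {0#} d {upper} {λ y → - lower y}
        (hasDegree-Σ-frob (λ i → suc (l ℕ.* i)) (λ i → s≤s (incr i)) P′)
        (hasDegree-< { - 1#} {p ℕ.^ (l ℕ.* P′)} {d} {λ y → - lower y} (ℕ.<⇒<′ (ℕ.^-monoʳ-< p 1<p (ℕ.n<1+n (l ℕ.* P′))))
          (hasDegree-neg {1#} (p ℕ.^ (l ℕ.* P′)) {lower} (hasDegree-Σ-frob (l ℕ.*_) incr P′))))
    pointwise : ∀ y → frob 1 (Tr y) - Tr y ≡ upper y + - lower y
    pointwise y = cong₂ _-_ (begin
      frob 1 (Tr y) ≡⟨ cong (frob 1) (Tr≡Σ y) ⟩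
      frob 1 (lower y) ≡⟨ frob-Σ 1 P _ ⟩
      Σ< P (λ i → frob 1 (frob (l ℕ.* i) y)) ≡⟨ Σ<-cong P (λ i _ → frob-frob 1 (l ℕ.* i) y) ⟩
      upper y ∎) (Tr≡Σ y)
    bound : d < size
    bound = subst (d <_) (sym size≡) (ℕ.^-monoʳ-< p 1<p
      (subst (λ k → suc (l ℕ.* P′) < l ℕ.+ k) (ℕ.*-comm l P′) (ℕ.+-monoˡ-< (l ℕ.* P′) 1<l)))

  -- With μ b = y^p - y the absolute trace cancels by Frobenius invariance, while Tr(b) is (Tr(y)^p
  -- - Tr(y)) / μ because g fixes μ.
  ∃tr≡0∧Tr≢0 : 1 < l → ∀ {μ} → μ ≢ 0# → InSub l μ → Σ F λ b → tr n (μ * b) ≡ 0# × Tr b ≢ 0#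
  ∃tr≡0∧Tr≢0 1<l {μ} μ≢0 fμ = μ ⁻¹ * (frob 1 y - y) , tr≡0 , λ eq → proj₂ (∃Tr∉Fₚ 1<l) (x*y≡0⇒y≡0 (inverse-nonzero μ≢0) (trans (sym Tr≡) eq))
    where
    open ≡-Reasoning
    y : F
    y = proj₁ (∃Tr∉Fₚ 1<l)
    tr≡0 : tr n (μ * (μ ⁻¹ * (frob 1 y - y))) ≡ 0#
    tr≡0 = begin
      tr n (μ * (μ ⁻¹ * (frob 1 y - y))) ≡⟨ cong (tr n) (trans (sym (*-assoc _ _ _)) (trans (cong (_* (frob 1 y - y)) (inverseʳ μ μ≢0)) (*-identityˡ _))) ⟩
      tr n (frob 1 y - y) ≡⟨ tr-- (frob 1 y) y ⟩
      tr n (frob 1 y) - tr n y ≡⟨ x≡y⇒x-y≡0 (tr-frob y) ⟩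
      0# ∎
    Tr≡ : Tr (μ ⁻¹ * (frob 1 y - y)) ≡ μ ⁻¹ * (frob 1 (Tr y) - Tr y)
    Tr≡ = begin
      Tr (μ ⁻¹ * (frob 1 y - y)) ≡⟨ iterate-D-* P′ (InSub-inverse {l} μ≢0 fμ) _ ⟩
      μ ⁻¹ * Tr (frob 1 y - y) ≡⟨ cong (μ ⁻¹ *_) (trans (iterate-+ P′ (frob 1 y) (- y)) (cong₂ _+_ (sym (iterate-D-frob P′ 1 y)) (iterate-D-neg P′ y))) ⟩
      μ ⁻¹ * (frob 1 (Tr y) - Tr y) ∎

  -- The descending filtration by images of powers of D, from the whole field down to 0 at index P;
  -- it measures how deep a coordinate lies in the lower central series.
  Im : ℕ → F → Set
  Im j x = Σ F λ v → x ≡ iterate D j v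

  Im-zero : ∀ x → Im 0 x
  Im-zero x = x , refl

  Im-0# : ∀ j {x} → x ≡ 0# → Im j x
  Im-0# j refl = 0# , sym (iterate-D-0 j)

  Im-+ : ∀ j {x y} → Im j x → Im j y → Im j (x + y)
  Im-+ j (v , refl) (w , refl) = v + w , sym (iterate-+ j v w)

  Im-neg : ∀ j {x} → Im j x → Im j (- x)
  Im-neg j (v , refl) = - v , sym (iterate-D-neg j v)

  Im-frob : ∀ j {x} k → Im j x → Im j (frob k x)
  Im-frob j k (v , refl) = frob k v , iterate-D-frob j k v

  -- g^k - 1 telescopes into the maps D g^i with i < k, so it raises the filtration index by one.
  Im-commutator : ∀ j {x} k → Im j x → Im (suc j) (frob (l ℕ.* k) x - x)
  Im-commutator j {x} zero i = Im-0# (suc j) (trans (cong (λ m → frob m x - x) (ℕ.*-zeroʳ l)) (x≡y⇒x-y≡0 (frob-zero x)))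
  Im-commutator j {x} (suc k) i = subst (Im (suc j)) (begin
    D y + (y - x) ≡⟨ solve 3 (λ x y z → (z :- y) :+ (y :- x) := z :- x) refl x y (g y) ⟩
    g y - x ≡⟨ cong (_- x) (trans (frob-frob l (l ℕ.* k) x) (cong (λ m → frob m x) (sym (ℕ.*-suc l k)))) ⟩
    frob (l ℕ.* suc k) x - x ∎) (Im-+ (suc j) (Im-D (Im-frob j (l ℕ.* k) i)) (Im-commutator j k i))
    where
    open ≡-Reasoning
    y = frob (l ℕ.* k) x
    Im-D : ∀ {z} → Im j z → Im (suc j) (D z)
    Im-D (v , refl) = v , refl

  Im-P : ∀ {x} → Im P x → x ≡ 0#
  Im-P (v , refl) = D^P≡0 v

-- The ambient group of pairs (E(a,b,c,t), g^k) in coordinates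

module Semilinear (K : FiniteField) (p : ℕ) (prime : Prime p) (P′ l : ℕ)
  (size≡ : FiniteField.size K ≡ p ℕ.^ (suc P′ ℕ.* l))
  (p∣PCj : ∀ j → 0 < j → j < suc P′ → p ∣ suc P′ C j) where

  open Twist K p prime P′ l size≡ p∣PCj public

  dot-cong : ∀ {a b c d a′ b′ c′ d′ : F} → a ≡ a′ → b ≡ b′ → c ≡ c′ → d ≡ d′ → a + b + c + d ≡ a′ + b′ + c′ + d′
  dot-cong refl refl refl refl = refl

  ⊛-cong : ∀ {A A′ B B′ : Mat} → (∀ i j → A i j ≡ A′ i j) → (∀ i j → B i j ≡ B′ i j) → ∀ i j → (A ⊛ B) i j ≡ (A′ ⊛ B′) i j
  ⊛-cong A≗ B≗ i j = dot-cong (cong₂ _*_ (A≗ i 0F) (B≗ 0F j)) (cong₂ _*_ (A≗ i 1F) (B≗ 1F j)) (cong₂ _*_ (A≗ i 2F) (B≗ 2F j)) (cong₂ _*_ (A≗ i 3F) (B≗ 3F j))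

  ⊛-assoc : ∀ (A B X : Mat) i j → ((A ⊛ B) ⊛ X) i j ≡ (A ⊛ (B ⊛ X)) i j
  ⊛-assoc A B X i j = trans (dot-cong (row 0F) (row 1F) (row 2F) (row 3F)) (trans transpose (sym (dot-cong (column 0F) (column 1F) (column 2F) (column 3F))))
    where
    m : Fin 4 → Fin 4 → F
    -- Both bracketings are the sum of these sixteen products, by columns in one case and by rows in
    -- the other.
    m h k = A i h * B h k * X k j
    row : ∀ k → (A ⊛ B) i k * X k j ≡ m 0F k + m 1F k + m 2F k + m 3F k
    row k = solve 5 (λ x y z w c → (x :+ y :+ z :+ w) :* c := x :* c :+ y :* c :+ z :* c :+ w :* c) refl
      (A i 0F * B 0F k) (A i 1F * B 1F k) (A i 2F * B 2F k) (A i 3F * B 3F k) (X k j)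
    column : ∀ h → A i h * (B ⊛ X) h j ≡ m h 0F + m h 1F + m h 2F + m h 3F
    column h = trans
      (solve 5 (λ x y z w c → c :* (x :+ y :+ z :+ w) := c :* x :+ c :* y :+ c :* z :+ c :* w) refl
        (B h 0F * X 0F j) (B h 1F * X 1F j) (B h 2F * X 2F j) (B h 3F * X 3F j) (A i h))
      (dot-cong (sym (*-assoc _ _ _)) (sym (*-assoc _ _ _)) (sym (*-assoc _ _ _)) (sym (*-assoc _ _ _)))
    interchange : ∀ a b c d e f g h → (a + b + c + d) + (e + f + g + h) ≡ (a + e) + (b + f) + (c + g) + (d + h)
    interchange = solve 8 (λ a b c d e f g h → (a :+ b :+ c :+ d) :+ (e :+ f :+ g :+ h) := (a :+ e) :+ (b :+ f) :+ (c :+ g) :+ (d :+ h)) refl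
    transpose : (m 0F 0F + m 1F 0F + m 2F 0F + m 3F 0F) + (m 0F 1F + m 1F 1F + m 2F 1F + m 3F 1F) + (m 0F 2F + m 1F 2F + m 2F 2F + m 3F 2F) + (m 0F 3F + m 1F 3F + m 2F 3F + m 3F 3F)
      ≡ (m 0F 0F + m 0F 1F + m 0F 2F + m 0F 3F) + (m 1F 0F + m 1F 1F + m 1F 2F + m 1F 3F) + (m 2F 0F + m 2F 1F + m 2F 2F + m 2F 3F) + (m 3F 0F + m 3F 1F + m 3F 2F + m 3F 3F)
    transpose = begin
      col 0F + col 1F + col 2F + col 3F ≡⟨ cong (λ z → z + col 2F + col 3F) (interchange (m 0F 0F) (m 1F 0F) (m 2F 0F) (m 3F 0F) (m 0F 1F) (m 1F 1F) (m 2F 1F) (m 3F 1F)) ⟩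
      _ + col 2F + col 3F ≡⟨ cong (_+ col 3F) (interchange (m 0F 0F + m 0F 1F) (m 1F 0F + m 1F 1F) (m 2F 0F + m 2F 1F) (m 3F 0F + m 3F 1F) (m 0F 2F) (m 1F 2F) (m 2F 2F) (m 3F 2F)) ⟩
      _ + col 3F ≡⟨ interchange (m 0F 0F + m 0F 1F + m 0F 2F) (m 1F 0F + m 1F 1F + m 1F 2F) (m 2F 0F + m 2F 1F + m 2F 2F) (m 3F 0F + m 3F 1F + m 3F 2F) (m 0F 3F) (m 1F 3F) (m 2F 3F) (m 3F 3F) ⟩
      _ ∎
      where
      open ≡-Reasoning
      col : Fin 4 → F
      col k = m 0F k + m 1F k + m 2F k + m 3F k

  ^σ-⊛ : ∀ k (A B : Mat) i j → ((A ⊛ B) ^σ k) i j ≡ ((A ^σ k) ⊛ (B ^σ k)) i j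
  ^σ-⊛ k A B i j = trans (frob-+ k _ _) (cong₂ _+_ (trans (frob-+ k _ _) (cong₂ _+_ (trans (frob-+ k _ _) (cong₂ _+_ (frob-* k _ _) (frob-* k _ _))) (frob-* k _ _))) (frob-* k _ _))

  -- _≈_ as a record, so that its arguments can be inferred.
  infix 4 _≃_
  record _≃_ (x y : Elem) : Set where
    constructor mk
    field un : x ≈ y
  open _≃_ public

  ≃-refl : ∀ {x} → x ≃ x
  ≃-refl = mk ((λ _ _ → refl) , λ _ → refl)

  ≃-sym : ∀ {x y} → x ≃ y → y ≃ x
  ≃-sym (mk (e , f)) = mk ((λ i j → sym (e i j)) , λ x → sym (f x))

  ≃-trans : ∀ {x y z} → x ≃ y → y ≃ z → x ≃ z
  ≃-trans (mk (e , f)) (mk (e′ , f′)) = mk ((λ i j → trans (e i j) (e′ i j)) , λ x → trans (f x) (f′ x))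

  ≃-setoid : Setoid 0ℓ 0ℓ
  ≃-setoid = record { Carrier = Elem ; _≈_ = _≃_ ; isEquivalence = record { refl = ≃-refl ; sym = ≃-sym ; trans = ≃-trans } }

  ∘ₑ-cong : ∀ {x x′ y y′} → x ≃ x′ → y ≃ y′ → x ∘ₑ y ≃ x′ ∘ₑ y′
  ∘ₑ-cong {A , k} {A′ , k′} {B , m} {B′ , m′} (mk (e , f)) (mk (e′ , f′)) = mk
    (⊛-cong {A ^σ m} {A′ ^σ m′} (λ i j → trans (f′ (A i j)) (cong (frob m′) (e i j))) e′ ,
    λ x → trans (sym (frob-frob k m x)) (trans (f (frob m x)) (trans (cong (frob k′) (f′ x)) (frob-frob k′ m′ x))))

  ∘ₑ-congˡ : ∀ x {y y′} → y ≃ y′ → x ∘ₑ y ≃ x ∘ₑ y′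
  ∘ₑ-congˡ x = ∘ₑ-cong {x} {x} ≃-refl

  ∘ₑ-congʳ : ∀ y {x x′} → x ≃ x′ → x ∘ₑ y ≃ x′ ∘ₑ y
  ∘ₑ-congʳ y e = ∘ₑ-cong {y = y} {y} e ≃-refl

  ∘ₑ-assoc : ∀ x y z → (x ∘ₑ y) ∘ₑ z ≃ x ∘ₑ (y ∘ₑ z)
  ∘ₑ-assoc (A , i) (B , j) (X , k) = mk (
    (λ r s → trans (⊛-cong {((A ^σ j) ⊛ B) ^σ k} {(A ^σ (j ℕ.+ k)) ⊛ (B ^σ k)} {X} {X}
        (λ r s → trans (^σ-⊛ k (A ^σ j) B r s) (⊛-cong {(A ^σ j) ^σ k} {A ^σ (j ℕ.+ k)} {B ^σ k} {B ^σ k}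
          (λ r s → trans (frob-frob k j (A r s)) (cong (λ m → frob m (A r s)) (ℕ.+-comm k j))) (λ _ _ → refl) r s))
        (λ _ _ → refl) r s)
      (⊛-assoc (A ^σ (j ℕ.+ k)) (B ^σ k) X r s)) ,
    λ x → cong (λ m → frob m x) (ℕ.+-assoc i j k))

  ∘ₑ-identityˡ : ∀ x → one ∘ₑ x ≃ x
  ∘ₑ-identityˡ (A , k) = mk (entries , λ _ → refl)
    where
    unit-row : ∀ {x y z w a b c d s : F} → (x * a + y * b + z * c + w * d ≡ s) → ∀ {x′ y′ z′ w′} → x′ ≡ x → y′ ≡ y → z′ ≡ z → w′ ≡ w → x′ * a + y′ * b + z′ * c + w′ * d ≡ s
    unit-row e refl refl refl refl = e
    e0 e1 : ∀ {m} → Polynomial m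
    e0 = con (0 , 0)
    e1 = con (1 , 0)
    entries : ∀ i j → ((Imat ^σ k) ⊛ A) i j ≡ A i j
    entries 0F j = unit-row (solve 4 (λ a b c d → e1 :* a :+ e0 :* b :+ e0 :* c :+ e0 :* d := a) refl (A 0F j) (A 1F j) (A 2F j) (A 3F j)) (frob-1# k) (frob-0 k) (frob-0 k) (frob-0 k)
    entries 1F j = unit-row (solve 4 (λ a b c d → e0 :* a :+ e1 :* b :+ e0 :* c :+ e0 :* d := b) refl (A 0F j) (A 1F j) (A 2F j) (A 3F j)) (frob-0 k) (frob-1# k) (frob-0 k) (frob-0 k)
    entries 2F j = unit-row (solve 4 (λ a b c d → e0 :* a :+ e0 :* b :+ e1 :* c :+ e0 :* d := c) refl (A 0F j) (A 1F j) (A 2F j) (A 3F j)) (frob-0 k) (frob-0 k) (frob-1# k) (frob-0 k)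
    entries 3F j = unit-row (solve 4 (λ a b c d → e0 :* a :+ e0 :* b :+ e0 :* c :+ e1 :* d := d) refl (A 0F j) (A 1F j) (A 2F j) (A 3F j)) (frob-0 k) (frob-0 k) (frob-0 k) (frob-1# k)

  record Coord : Set where
    constructor coord
    field
      a b c t : F
      k : ℕ

  φ : ℕ → F → F
  φ k = frob (l ℕ.* k)

  emb : Coord → Elem
  emb (coord a b c t k) = E a b c t , l ℕ.* k

  infix 4 _≋_
  -- Exponents are compared through the automorphisms they define, since k matters only modulo P.
  record _≋_ (x y : Coord) : Set where
    constructor mk≋
    open Coord
    field
      a≡ : a x ≡ a y
      b≡ : b x ≡ b y
      c≡ : c x ≡ c y
      t≡ : t x ≡ t y
      k≡ : ∀ z → φ (k x) z ≡ φ (k y) z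

  infixl 7 _∙_
  -- Read off from the last row of the twisted matrix product and from its entry t. `E-⊛` checks the
  -- other entries; there the term b - ct is what keeps the shape closed under products.
  _∙_ : Coord → Coord → Coord
  coord a b c t k ∙ coord a′ b′ c′ t′ k′ = coord
    (φ k′ a + a′ - φ k′ b * c′ + φ k′ c * (b′ - c′ * t′))
    (φ k′ b + b′ + φ k′ c * t′)
    (φ k′ c + c′)
    (φ k′ t + t′)
    (k ℕ.+ k′)

  ε : Coord
  ε = coord 0# 0# 0# 0# 0

  infix 8 _⁻
  -- Exponents are natural numbers, so g^(-k) is written g^((P - 1)k). It is applied to the
  -- coordinates (-a, ct - b, -c, -t) of the inverse matrix.
  _⁻ : Coord → Coord
  coord a b c t k ⁻ = coord (- ψ a) (ψ c * ψ t - ψ b) (- ψ c) (- ψ t) (P′ ℕ.* k)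
    where
    ψ : F → F
    ψ = φ (P′ ℕ.* k)

  E-cong : ∀ {a b c t a′ b′ c′ t′} → a ≡ a′ → b ≡ b′ → c ≡ c′ → t ≡ t′ → ∀ i j → E a b c t i j ≡ E a′ b′ c′ t′ i j
  E-cong refl refl refl refl i j = refl

  emb-cong : ∀ {x y} → x ≋ y → emb x ≃ emb y
  emb-cong (mk≋ a≡ b≡ c≡ t≡ k≡) = mk (E-cong a≡ b≡ c≡ t≡ , k≡)

  emb-injective : ∀ {x y} → emb x ≃ emb y → x ≋ y
  emb-injective (mk (e , f)) = mk≋ (e 3F 0F) (e 3F 1F) (e 3F 2F) (e 2F 1F) f

  E-^σ : ∀ m a b c t i j → (E a b c t ^σ m) i j ≡ E (frob m a) (frob m b) (frob m c) (frob m t) i j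
  E-^σ m a b c t 0F 0F = frob-1# m
  E-^σ m a b c t 0F (suc j) = frob-0 m
  E-^σ m a b c t 1F 0F = frob-neg m c
  E-^σ m a b c t 1F 1F = frob-1# m
  E-^σ m a b c t 1F (suc (suc j)) = frob-0 m
  E-^σ m a b c t 2F 0F = trans (frob-- m b (c * t)) (cong (λ z → frob m b - z) (frob-* m c t))
  E-^σ m a b c t 2F 1F = refl
  E-^σ m a b c t 2F 2F = frob-1# m
  E-^σ m a b c t 2F 3F = frob-0 m
  E-^σ m a b c t 3F 0F = refl
  E-^σ m a b c t 3F 1F = refl
  E-^σ m a b c t 3F 2F = refl
  E-^σ m a b c t 3F 3F = frob-1# m

  E-⊛ : ∀ a b c t a′ b′ c′ t′ i j → (E a b c t ⊛ E a′ b′ c′ t′) i j ≡ E (a + a′ - b * c′ + c * (b′ - c′ * t′)) (b + b′ + c * t′) (c + c′) (t + t′) i j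
  E-⊛ a b c t a′ b′ c′ t′ = entries
    where
    e0 e1 : ∀ {m} → Polynomial m
    e0 = con (0 , 0)
    e1 = con (1 , 0)
    entries : ∀ i j → (E a b c t ⊛ E a′ b′ c′ t′) i j ≡ E (a + a′ - b * c′ + c * (b′ - c′ * t′)) (b + b′ + c * t′) (c + c′) (t + t′) i j
    entries 0F 0F = solve 3 (λ x y z → e1 :* e1 :+ e0 :* x :+ e0 :* y :+ e0 :* z := e1) refl (- c′) (b′ - c′ * t′) a′
    entries 0F 1F = solve 2 (λ x y → e1 :* e0 :+ e0 :* e1 :+ e0 :* x :+ e0 :* y := e0) refl t′ b′
    entries 0F 2F = solve 1 (λ x → e1 :* e0 :+ e0 :* e0 :+ e0 :* e1 :+ e0 :* x := e0) refl c′
    entries 0F 3F = solve 0 (e1 :* e0 :+ e0 :* e0 :+ e0 :* e0 :+ e0 :* e1 := e0) refl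
    entries 1F 0F = solve 4 (λ c c′ x y → (:- c) :* e1 :+ e1 :* (:- c′) :+ e0 :* x :+ e0 :* y := :- (c :+ c′)) refl c c′ (b′ - c′ * t′) a′
    entries 1F 1F = solve 3 (λ c x y → (:- c) :* e0 :+ e1 :* e1 :+ e0 :* x :+ e0 :* y := e1) refl c t′ b′
    entries 1F 2F = solve 2 (λ c x → (:- c) :* e0 :+ e1 :* e0 :+ e0 :* e1 :+ e0 :* x := e0) refl c c′
    entries 1F 3F = solve 1 (λ c → (:- c) :* e0 :+ e1 :* e0 :+ e0 :* e0 :+ e0 :* e1 := e0) refl c
    entries 2F 0F = solve 7 (λ b c t a′ b′ c′ t′ → (b :- c :* t) :* e1 :+ t :* (:- c′) :+ e1 :* (b′ :- c′ :* t′) :+ e0 :* a′ := (b :+ b′ :+ c :* t′) :- (c :+ c′) :* (t :+ t′)) refl b c t a′ b′ c′ t′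
    entries 2F 1F = solve 4 (λ x t t′ b′ → x :* e0 :+ t :* e1 :+ e1 :* t′ :+ e0 :* b′ := t :+ t′) refl (b - c * t) t t′ b′
    entries 2F 2F = solve 3 (λ x t y → x :* e0 :+ t :* e0 :+ e1 :* e1 :+ e0 :* y := e1) refl (b - c * t) t c′
    entries 2F 3F = solve 2 (λ x t → x :* e0 :+ t :* e0 :+ e1 :* e0 :+ e0 :* e1 := e0) refl (b - c * t) t
    entries 3F 0F = solve 7 (λ a b c a′ b′ c′ t′ → a :* e1 :+ b :* (:- c′) :+ c :* (b′ :- c′ :* t′) :+ e1 :* a′ := a :+ a′ :- b :* c′ :+ c :* (b′ :- c′ :* t′)) refl a b c a′ b′ c′ t′
    entries 3F 1F = solve 5 (λ a b c b′ t′ → a :* e0 :+ b :* e1 :+ c :* t′ :+ e1 :* b′ := b :+ b′ :+ c :* t′) refl a b c b′ t′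
    entries 3F 2F = solve 4 (λ a b c c′ → a :* e0 :+ b :* e0 :+ c :* e1 :+ e1 :* c′ := c :+ c′) refl a b c c′
    entries 3F 3F = solve 3 (λ a b c → a :* e0 :+ b :* e0 :+ c :* e0 :+ e1 :* e1 := e1) refl a b c

  emb-∙ : ∀ x y → emb x ∘ₑ emb y ≃ emb (x ∙ y)
  emb-∙ (coord a b c t k) (coord a′ b′ c′ t′ k′) = mk (
    (λ i j → trans (⊛-cong {E a b c t ^σ (l ℕ.* k′)} {E (φ k′ a) (φ k′ b) (φ k′ c) (φ k′ t)} {E a′ b′ c′ t′} {E a′ b′ c′ t′} (E-^σ (l ℕ.* k′) a b c t) (λ _ _ → refl) i j) (E-⊛ (φ k′ a) (φ k′ b) (φ k′ c) (φ k′ t) a′ b′ c′ t′ i j)) ,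
    λ x → cong (λ m → frob m x) (sym (ℕ.*-distribˡ-+ l k k′)))

  emb-ε : emb ε ≃ one
  emb-ε = mk (entries , λ x → cong (λ m → frob m x) (ℕ.*-zeroʳ l))
    where
    entries : ∀ i j → E 0# 0# 0# 0# i j ≡ Imat i j
    entries 0F 0F = refl
    entries 0F 1F = refl
    entries 0F 2F = refl
    entries 0F 3F = refl
    entries 1F 0F = -0#≈0#
    entries 1F 1F = refl
    entries 1F 2F = refl
    entries 1F 3F = refl
    entries 2F 0F = solve 0 (con (0 , 0) :- con (0 , 0) :* con (0 , 0) := con (0 , 0)) refl
    entries 2F 1F = refl
    entries 2F 2F = refl
    entries 2F 3F = refl
    entries 3F 0F = refl
    entries 3F 1F = refl
    entries 3F 2F = refl
    entries 3F 3F = refl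

  ≋-refl : ∀ {x} → x ≋ x
  ≋-refl = mk≋ refl refl refl refl (λ _ → refl)

  ≋-sym : ∀ {x y} → x ≋ y → y ≋ x
  ≋-sym e = emb-injective (≃-sym (emb-cong e))

  ≋-trans : ∀ {x y z} → x ≋ y → y ≋ z → x ≋ z
  ≋-trans e f = emb-injective (≃-trans (emb-cong e) (emb-cong f))

  ∙-cong : ∀ {x x′ y y′} → x ≋ x′ → y ≋ y′ → x ∙ y ≋ x′ ∙ y′
  ∙-cong {x} {x′} {y} {y′} e f = emb-injective (≃-trans (≃-sym (emb-∙ x y)) (≃-trans (∘ₑ-cong (emb-cong e) (emb-cong f)) (emb-∙ x′ y′)))

  ∙-congˡ : ∀ x {y y′} → y ≋ y′ → x ∙ y ≋ x ∙ y′
  ∙-congˡ x = ∙-cong {x} {x} ≋-refl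

  ∙-congʳ : ∀ y {x x′} → x ≋ x′ → x ∙ y ≋ x′ ∙ y
  ∙-congʳ y e = ∙-cong {y = y} {y} e ≋-refl

  -- Pulled back along the injective `emb`, so associativity comes from matrices and not from an
  -- identity in twelve twisted variables.
  ∙-assoc : ∀ x y z → (x ∙ y) ∙ z ≋ x ∙ (y ∙ z)
  ∙-assoc x y z = emb-injective
    (≃-trans (≃-sym (≃-trans (∘ₑ-congʳ (emb z) (emb-∙ x y)) (emb-∙ (x ∙ y) z)))
    (≃-trans (∘ₑ-assoc (emb x) (emb y) (emb z))
    (≃-trans (∘ₑ-congˡ (emb x) (emb-∙ y z)) (emb-∙ x (y ∙ z)))))

  ∙-identityˡ : ∀ x → ε ∙ x ≋ x
  ∙-identityˡ x = emb-injective (≃-trans (≃-sym (emb-∙ ε x)) (≃-trans (∘ₑ-congʳ (emb x) emb-ε) (∘ₑ-identityˡ (emb x))))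

  φ-zero : ∀ x → φ 0 x ≡ x
  φ-zero x = trans (cong (λ m → frob m x) (ℕ.*-zeroʳ l)) (frob-zero x)

  ∙-identityʳ : ∀ x → x ∙ ε ≋ x
  ∙-identityʳ (coord a b c t k) = mk≋
    (trans (solve 3 (λ a b c → a :+ e0 :- b :* e0 :+ c :* (e0 :- e0 :* e0) := a) refl (φ 0 a) (φ 0 b) (φ 0 c)) (φ-zero a))
    (trans (solve 2 (λ b c → b :+ e0 :+ c :* e0 := b) refl (φ 0 b) (φ 0 c)) (φ-zero b))
    (trans (+-identityʳ _) (φ-zero c))
    (trans (+-identityʳ _) (φ-zero t))
    (λ x → cong (λ m → φ m x) (ℕ.+-identityʳ k))
    where
    e0 : ∀ {m} → Polynomial m
    e0 = con (0 , 0)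

  φ-inverseˡ : ∀ k x → φ (P′ ℕ.* k ℕ.+ k) x ≡ x
  φ-inverseˡ k x = trans (cong (λ m → φ m x) (ℕ.+-comm (P′ ℕ.* k) k)) (frob-lP k x)

  φ-φ : ∀ j k x → φ j (φ k x) ≡ φ (j ℕ.+ k) x
  φ-φ j k x = trans (frob-frob (l ℕ.* j) (l ℕ.* k) x) (cong (λ m → frob m x) (sym (ℕ.*-distribˡ-+ l j k)))

  ∙-inverseˡ : ∀ x → x ⁻ ∙ x ≋ ε
  ∙-inverseˡ (coord a b c t k) = mk≋
    (begin
    φ k (- ψ a) + a - φ k (ψ c * ψ t - ψ b) * c + φ k (- ψ c) * (b - c * t)
      ≡⟨ cong₂ (λ u v → u + v * (b - c * t)) (cong₂ (λ u v → u + a - v * c) φψ-a φψ-b) φψ-c ⟩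
    - a + a - (c * t - b) * c + - c * (b - c * t)
      ≡⟨ solve 4 (λ a b c t → (:- a) :+ a :- (c :* t :- b) :* c :+ (:- c) :* (b :- c :* t) := con (0 , 0)) refl a b c t ⟩
    0# ∎)
    (begin
    φ k (ψ c * ψ t - ψ b) + b + φ k (- ψ c) * t ≡⟨ cong₂ (λ u v → u + b + v * t) φψ-b φψ-c ⟩
    (c * t - b) + b + - c * t ≡⟨ solve 3 (λ b c t → (c :* t :- b) :+ b :+ (:- c) :* t := con (0 , 0)) refl b c t ⟩
    0# ∎)
    (trans (cong (_+ c) φψ-c) (-‿inverseˡ c))
    (trans (cong (_+ t) (φψ-neg t)) (-‿inverseˡ t))
    (λ x → trans (φ-inverseˡ k x) (sym (φ-zero x)))
    where
    open ≡-Reasoning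
    ψ : F → F
    ψ = φ (P′ ℕ.* k)
    φψ : ∀ x → φ k (ψ x) ≡ x
    φψ x = trans (φ-φ k (P′ ℕ.* k) x) (frob-lP k x)
    φψ-neg : ∀ x → φ k (- ψ x) ≡ - x
    φψ-neg x = trans (frob-neg (l ℕ.* k) (ψ x)) (cong -_ (φψ x))
    φψ-a = φψ-neg a
    φψ-c = φψ-neg c
    φψ-b : φ k (ψ c * ψ t - ψ b) ≡ c * t - b
    φψ-b = trans (frob-- (l ℕ.* k) (ψ c * ψ t) (ψ b)) (cong₂ _-_ (trans (frob-* (l ℕ.* k) (ψ c) (ψ t)) (cong₂ _*_ (φψ c) (φψ t))) (φψ b))

  ∙-inverseʳ : ∀ x → x ∙ x ⁻ ≋ ε
  ∙-inverseʳ (coord a b c t k) = mk≋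
    (solve 4 (λ a b c t → a :+ (:- a) :- b :* (:- c) :+ c :* ((c :* t :- b) :- (:- c) :* (:- t)) := con (0 , 0)) refl (ψ a) (ψ b) (ψ c) (ψ t))
    (solve 3 (λ b c t → b :+ (c :* t :- b) :+ c :* (:- t) := con (0 , 0)) refl (ψ b) (ψ c) (ψ t))
    (-‿inverseʳ (ψ c))
    (-‿inverseʳ (ψ t))
    (λ x → trans (frob-lP k x) (sym (φ-zero x)))
    where
    ψ : F → F
    ψ = φ (P′ ℕ.* k)

  -- Uniqueness of inverses, x⁻ = x⁻ (y y⁻) = x⁻ (x y⁻) = y⁻, avoids comparing the multiplied raw
  -- exponents.
  ⁻-cong : ∀ {x y} → x ≋ y → x ⁻ ≋ y ⁻
  ⁻-cong {x} {y} e =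
    ≋-trans (≋-sym (∙-identityʳ (x ⁻)))
    (≋-trans (∙-congˡ (x ⁻) (≋-sym (∙-inverseʳ y)))
    (≋-trans (∙-congˡ (x ⁻) (∙-congʳ (y ⁻) (≋-sym e)))
    (≋-trans (≋-sym (∙-assoc (x ⁻) x (y ⁻)))
    (≋-trans (∙-congʳ (y ⁻) (∙-inverseˡ x)) (∙-identityˡ (y ⁻))))))

  ambient : Group 0ℓ 0ℓ
  ambient = record
    { Carrier = Coord
    ; _≈_ = _≋_
    ; _∙_ = _∙_
    ; ε = ε
    ; _⁻¹ = _⁻
    ; isGroup = record
      { isMonoid = record
        { isSemigroup = record
          { isMagma = record
            { isEquivalence = record { refl = ≋-refl ; sym = ≋-sym ; trans = ≋-trans }
            ; ∙-cong = ∙-cong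
            }
          ; assoc = ∙-assoc
          }
        ; identity = ∙-identityˡ , ∙-identityʳ
        }
      ; inverse = ∙-inverseˡ , ∙-inverseʳ
      ; ⁻¹-cong = ⁻-cong
      }
    }

  -- `inv` and `IsComm` describe their elements by equations; this solves such an equation inside
  -- the ambient group.
  solve-emb : ∀ u v {z} → emb u ∘ₑ z ≃ emb v → z ≃ emb (u ⁻ ∙ v)
  solve-emb u v {z} e = begin
    z ≈⟨ ∘ₑ-identityˡ z ⟨
    one ∘ₑ z ≈⟨ ∘ₑ-congʳ z (≃-trans (emb-cong (∙-inverseˡ u)) emb-ε) ⟨
    emb (u ⁻ ∙ u) ∘ₑ z ≈⟨ ∘ₑ-congʳ z (emb-∙ (u ⁻) u) ⟨
    (emb (u ⁻) ∘ₑ emb u) ∘ₑ z ≈⟨ ∘ₑ-assoc (emb (u ⁻)) (emb u) z ⟩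
    emb (u ⁻) ∘ₑ (emb u ∘ₑ z) ≈⟨ ∘ₑ-congˡ (emb (u ⁻)) e ⟩
    emb (u ⁻) ∘ₑ emb v ≈⟨ emb-∙ (u ⁻) v ⟩
    emb (u ⁻ ∙ v) ∎
    where open import Relation.Binary.Reasoning.Setoid ≃-setoid

  comm : Coord → Coord → Coord
  comm x y = (y ∙ x) ⁻ ∙ (x ∙ y)

  comm-unique : ∀ {x y z} x′ y′ → x ≃ emb x′ → y ≃ emb y′ → IsComm x y z → z ≃ emb (comm x′ y′)
  comm-unique {x} {y} {z} x′ y′ ex ey yxz≈xy = solve-emb (y′ ∙ x′) (x′ ∙ y′) (begin
    emb (y′ ∙ x′) ∘ₑ z ≈⟨ ∘ₑ-congʳ z (≃-trans (∘ₑ-cong ey ex) (emb-∙ y′ x′)) ⟨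
    (y ∘ₑ x) ∘ₑ z ≈⟨ mk yxz≈xy ⟩
    x ∘ₑ y ≈⟨ ∘ₑ-cong ex ey ⟩
    emb x′ ∘ₑ emb y′ ≈⟨ emb-∙ x′ y′ ⟩
    emb (x′ ∙ y′) ∎)
    where open import Relation.Binary.Reasoning.Setoid ≃-setoid

  isComm-emb : ∀ x y {z} → y ∙ x ∙ z ≋ x ∙ y → IsComm (emb x) (emb y) (emb z)
  isComm-emb x y {z} e = un (begin
    (emb y ∘ₑ emb x) ∘ₑ emb z ≈⟨ ∘ₑ-congʳ (emb z) (emb-∙ y x) ⟩
    emb (y ∙ x) ∘ₑ emb z ≈⟨ emb-∙ (y ∙ x) z ⟩
    emb (y ∙ x ∙ z) ≈⟨ emb-cong e ⟩
    emb (x ∙ y) ≈⟨ emb-∙ x y ⟨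
    emb x ∘ₑ emb y ∎)
    where open import Relation.Binary.Reasoning.Setoid ≃-setoid

  y∙x∙comm : ∀ x y → y ∙ x ∙ comm x y ≋ x ∙ y
  y∙x∙comm x y = \\-leftDividesˡ (y ∙ x) (x ∙ y)
    where open import Algebra.Properties.Group ambient using (\\-leftDividesˡ)

-- Commutator calculus and the upper central series

-- On the subgroup generated by L, Central i cuts out the i-th term of the upper central series,
-- although it only tests commutators with the members of L; this makes it decidable.
module UpperCentralSeries (G : Group 0ℓ 0ℓ) (L : List (Group.Carrier G)) where
  open Group G renaming (refl to ≈-refl; sym to ≈-sym; trans to ≈-trans)
  open Algebra.Properties.Group G
  open import Relation.Binary.Reasoning.Setoid setoid
  open import Algebra.Solver.Monoid monoid using (solve; _⊜_; _⊕_)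

  [_,_] conj : Carrier → Carrier → Carrier
  [ x , y ] = (y ∙ x) ⁻¹ ∙ (x ∙ y)
  conj y x = y ⁻¹ ∙ x ∙ y

  yx[x,y] : ∀ x y → y ∙ x ∙ [ x , y ] ≈ x ∙ y
  yx[x,y] x y = \\-leftDividesˡ (y ∙ x) (x ∙ y)

  -- Turns each commutator identity below into an equation between products, so that no inverse of a
  -- product has to be expanded.
  []-unique : ∀ x y z → y ∙ x ∙ z ≈ x ∙ y → [ x , y ] ≈ z
  []-unique x y z e = ≈-sym (y≈x\\z (y ∙ x) z (x ∙ y) e)

  []-cong : ∀ {x x′ y y′} → x ≈ x′ → y ≈ y′ → [ x , y ] ≈ [ x′ , y′ ]
  []-cong e f = ∙-cong (⁻¹-cong (∙-cong f e)) (∙-cong e f)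

  [x,ε] : ∀ x → [ x , ε ] ≈ ε
  [x,ε] x = []-unique x ε ε (≈-trans (identityʳ _) (≈-trans (identityˡ x) (≈-sym (identityʳ x))))

  [ε,y] : ∀ y → [ ε , y ] ≈ ε
  [ε,y] y = []-unique ε y ε (≈-trans (identityʳ _) (≈-trans (identityʳ y) (≈-sym (identityˡ y))))

  y∙conj : ∀ y x → y ∙ conj y x ≈ x ∙ y
  y∙conj y x = ≈-trans (solve 3 (λ y i x → y ⊕ ((i ⊕ x) ⊕ y) ⊜ y ⊕ (i ⊕ (x ⊕ y))) ≈-refl y (y ⁻¹) x) (\\-leftDividesˡ y (x ∙ y))

  [x,yz] : ∀ x y z → [ x , y ∙ z ] ≈ [ x , z ] ∙ conj z [ x , y ]
  [x,yz] x y z = []-unique x (y ∙ z) _ (begin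
    y ∙ z ∙ x ∙ ([ x , z ] ∙ conj z [ x , y ]) ≈⟨ solve 5 (λ y z x u v → ((y ⊕ z) ⊕ x) ⊕ (u ⊕ v) ⊜ (y ⊕ ((z ⊕ x) ⊕ u)) ⊕ v) ≈-refl y z x [ x , z ] (conj z [ x , y ]) ⟩
    y ∙ (z ∙ x ∙ [ x , z ]) ∙ conj z [ x , y ] ≈⟨ ∙-congʳ (∙-congˡ (yx[x,y] x z)) ⟩
    y ∙ (x ∙ z) ∙ conj z [ x , y ] ≈⟨ solve 4 (λ y x z u → (y ⊕ (x ⊕ z)) ⊕ u ⊜ (y ⊕ x) ⊕ (z ⊕ u)) ≈-refl y x z (conj z [ x , y ]) ⟩
    (y ∙ x) ∙ (z ∙ conj z [ x , y ]) ≈⟨ ∙-congˡ (y∙conj z [ x , y ]) ⟩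
    (y ∙ x) ∙ ([ x , y ] ∙ z) ≈⟨ assoc _ _ _ ⟨
    (y ∙ x) ∙ [ x , y ] ∙ z ≈⟨ ∙-congʳ (yx[x,y] x y) ⟩
    x ∙ y ∙ z ≈⟨ assoc _ _ _ ⟩
    x ∙ (y ∙ z) ∎)

  [x,y⁻¹] : ∀ x y → [ x , y ⁻¹ ] ≈ conj (y ⁻¹) [ x , y ] ⁻¹
  [x,y⁻¹] x y = inverseˡ-unique _ _ (begin
    [ x , y ⁻¹ ] ∙ conj (y ⁻¹) [ x , y ] ≈⟨ [x,yz] x y (y ⁻¹) ⟨
    [ x , y ∙ y ⁻¹ ] ≈⟨ []-cong ≈-refl (inverseʳ y) ⟩
    [ x , ε ] ≈⟨ [x,ε] x ⟩
    ε ∎)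

  [xx′,y] : ∀ x x′ y → [ x ∙ x′ , y ] ≈ conj x′ [ x , y ] ∙ [ x′ , y ]
  [xx′,y] x x′ y = []-unique (x ∙ x′) y _ (begin
    y ∙ (x ∙ x′) ∙ (conj x′ [ x , y ] ∙ [ x′ , y ]) ≈⟨ solve 5 (λ y x x′ u v → (y ⊕ (x ⊕ x′)) ⊕ (u ⊕ v) ⊜ ((y ⊕ x) ⊕ (x′ ⊕ u)) ⊕ v) ≈-refl y x x′ (conj x′ [ x , y ]) [ x′ , y ] ⟩
    (y ∙ x) ∙ (x′ ∙ conj x′ [ x , y ]) ∙ [ x′ , y ] ≈⟨ ∙-congʳ (∙-congˡ (y∙conj x′ [ x , y ])) ⟩
    (y ∙ x) ∙ ([ x , y ] ∙ x′) ∙ [ x′ , y ] ≈⟨ ∙-congʳ (assoc _ _ _) ⟨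
    (y ∙ x) ∙ [ x , y ] ∙ x′ ∙ [ x′ , y ] ≈⟨ ∙-congʳ (∙-congʳ (yx[x,y] x y)) ⟩
    x ∙ y ∙ x′ ∙ [ x′ , y ] ≈⟨ solve 4 (λ x y x′ u → ((x ⊕ y) ⊕ x′) ⊕ u ⊜ x ⊕ ((y ⊕ x′) ⊕ u)) ≈-refl x y x′ [ x′ , y ] ⟩
    x ∙ (y ∙ x′ ∙ [ x′ , y ]) ≈⟨ ∙-congˡ (yx[x,y] x′ y) ⟩
    x ∙ (x′ ∙ y) ≈⟨ assoc _ _ _ ⟨
    x ∙ x′ ∙ y ∎)

  [x⁻¹,y] : ∀ x y → [ x ⁻¹ , y ] ≈ conj (x ⁻¹) [ x , y ] ⁻¹
  [x⁻¹,y] x y = inverseʳ-unique _ _ (begin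
    conj (x ⁻¹) [ x , y ] ∙ [ x ⁻¹ , y ] ≈⟨ [xx′,y] x (x ⁻¹) y ⟨
    [ x ∙ x ⁻¹ , y ] ≈⟨ []-cong (inverseʳ x) ≈-refl ⟩
    [ ε , y ] ≈⟨ [ε,y] y ⟩
    ε ∎)

  conj≈x[x,y] : ∀ x y → conj y x ≈ x ∙ [ x , y ]
  conj≈x[x,y] x y = ∙-cancelˡ y _ _ (≈-trans (y∙conj y x) (≈-trans (≈-sym (yx[x,y] x y)) (assoc _ _ _)))

  [x,y]≈x⁻¹conj : ∀ x y → [ x , y ] ≈ x ⁻¹ ∙ conj y x
  [x,y]≈x⁻¹conj x y = y≈x\\z x _ _ (≈-sym (conj≈x[x,y] x y))

  data Generated : Carrier → Set where
    gen  : ∀ {x} → x ∈ L → Generated x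
    unit : Generated ε
    mul  : ∀ {x y} → Generated x → Generated y → Generated (x ∙ y)
    inv  : ∀ {x} → Generated x → Generated (x ⁻¹)
    resp : ∀ {x y} → Generated x → x ≈ y → Generated y

  Central : ℕ → Carrier → Set
  Central zero x = x ≈ ε
  Central (suc i) x = All (λ y → Central i [ x , y ]) L

  central? : (∀ x y → Dec (x ≈ y)) → ∀ i x → Dec (Central i x)
  central? _≟_ zero x = x ≟ ε
  central? _≟_ (suc i) x = All.all? (λ y → central? _≟_ i [ x , y ]) L

  central-resp : ∀ i {x y} → x ≈ y → Central i x → Central i y
  central-resp zero e x≈ε = ≈-trans (≈-sym e) x≈ε
  central-resp (suc i) e cx = All.map (central-resp i ([]-cong e ≈-refl)) cx

  Z : ℕ → Carrier → Set
  Z i x = Generated x × Central i x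

  record IsNormal (Q : Carrier → Set) : Set where
    field
      Q-resp : ∀ {x y} → x ≈ y → Q x → Q y
      Q-ε : Q ε
      Q-∙ : ∀ {x y} → Q x → Q y → Q (x ∙ y)
      Q-⁻¹ : ∀ {x} → Q x → Q (x ⁻¹)
      Q-conj : ∀ {x y} → Q x → Generated y → Q (conj y x)

  conj-ε : ∀ {x} y → x ≈ ε → conj y x ≈ ε
  conj-ε y e = ≈-trans (∙-congʳ (≈-trans (∙-congˡ e) (identityʳ _))) (inverseˡ y)

  generated-conj : ∀ {x y} → Generated x → Generated y → Generated (conj y x)
  generated-conj sx sy = mul (mul (inv sy) sx) sy

  module _ {i} (normal : IsNormal (Z i)) where
    open IsNormal normal

    -- Passes from the listed generators to everything they generate: the commutator identities
    -- produce conjugates, which the normality of `Z i` absorbs.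
    Z-[] : ∀ {x y} → Z (suc i) x → Generated y → Z i [ x , y ]
    Z-[] {x} (sx , cx) (gen y∈L) = mul (inv (mul (gen y∈L) sx)) (mul sx (gen y∈L)) , All.lookup cx y∈L
    Z-[] {x} zx unit = Q-resp (≈-sym ([x,ε] x)) Q-ε
    Z-[] {x} zx (mul {y} {z} sy sz) = Q-resp (≈-sym ([x,yz] x y z)) (Q-∙ (Z-[] zx sz) (Q-conj (Z-[] zx sy) sz))
    Z-[] {x} zx (inv {y} sy) = Q-resp (≈-sym ([x,y⁻¹] x y)) (Q-⁻¹ (Q-conj (Z-[] zx sy) (inv sy)))
    Z-[] {x} zx (resp sy e) = Q-resp ([]-cong ≈-refl e) (Z-[] zx sy)

    Z-intro : ∀ {x} → Generated x → (∀ {y} → Generated y → Z i [ x , y ]) → Z (suc i) x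
    Z-intro sx h = sx , All.tabulate (λ y∈L → proj₂ (h (gen y∈L)))

    Z⊆Z-suc : ∀ {x} → Z i x → Z (suc i) x
    Z⊆Z-suc {x} zx = Z-intro (proj₁ zx) (λ {y} sy → Q-resp (≈-sym ([x,y]≈x⁻¹conj x y)) (Q-∙ (Q-⁻¹ zx) (Q-conj zx sy)))

    suc-∙ : ∀ {x x′} → Z (suc i) x → Z (suc i) x′ → Z (suc i) (x ∙ x′)
    suc-∙ {x} {x′} zx zx′ = Z-intro (mul (proj₁ zx) (proj₁ zx′)) (λ {y} sy → Q-resp (≈-sym ([xx′,y] x x′ y)) (Q-∙ (Q-conj (Z-[] zx sy) (proj₁ zx′)) (Z-[] zx′ sy)))

    suc-normal : IsNormal (Z (suc i))
    suc-normal = record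
      { Q-resp = λ e (sx , cx) → resp sx e , central-resp (suc i) e cx
      ; Q-ε = Z-intro unit (λ {y} sy → Q-resp (≈-sym ([ε,y] y)) Q-ε)
      ; Q-∙ = suc-∙
      ; Q-⁻¹ = λ {x} zx → Z-intro (inv (proj₁ zx)) (λ {y} sy → Q-resp (≈-sym ([x⁻¹,y] x y)) (Q-⁻¹ (Q-conj (Z-[] zx sy) (inv (proj₁ zx)))))
      -- The conjugate is x [x , y], and [x , y] lies in `Z i`, hence in `Z (suc i)`.
      ; Q-conj = λ {x} {y} zx sy → generated-conj (proj₁ zx) sy ,
          central-resp (suc i) (≈-sym (conj≈x[x,y] x y)) (proj₂ (suc-∙ zx (Z⊆Z-suc (Z-[] zx sy))))
      }

  Z-normal : ∀ i → IsNormal (Z i)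
  Z-normal zero = record
    { Q-resp = λ e (sx , cx) → resp sx e , central-resp zero e cx
    ; Q-ε = unit , ≈-refl
    ; Q-∙ = λ (sx , e) (sy , f) → mul sx sy , (≈-trans (∙-cong e f) (identityˡ ε))
    ; Q-⁻¹ = λ (sx , e) → inv sx , (≈-trans (⁻¹-cong e) ε⁻¹≈ε)
    ; Q-conj = λ {x} {y} (sx , e) sy → generated-conj sx sy , (conj-ε y e)
    }
  Z-normal (suc i) = suc-normal {i} (Z-normal i)

  generated⊆Z : ∀ i → All (Central i) L → ∀ {x} → Generated x → Z i x
  generated⊆Z i cL (gen x∈L) = gen x∈L , All.lookup cL x∈L
  generated⊆Z i cL unit = IsNormal.Q-ε (Z-normal i)
  generated⊆Z i cL (mul sx sy) = IsNormal.Q-∙ (Z-normal i) (generated⊆Z i cL sx) (generated⊆Z i cL sy)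
  generated⊆Z i cL (inv sx) = IsNormal.Q-⁻¹ (Z-normal i) (generated⊆Z i cL sx)
  generated⊆Z i cL (resp sx e) = IsNormal.Q-resp (Z-normal i) e (generated⊆Z i cL sx)

-- The two conditions on the result are the two halves of `NilpotencyClass`, so the search returns
-- the class itself.
least : {Q : ℕ → Set} → (∀ d → Dec (Q d)) → ∀ N → Q N → Σ ℕ λ c → Q c × (∀ d → Q d → c ≤ d)
least Q? N qN with Q? 0
... | yes q0 = 0 , q0 , λ _ _ → z≤n
least Q? zero q0 | no ¬q0 = contradiction q0 ¬q0
least {Q} Q? (suc N) qN | no ¬q0 with least {Q ∘ suc} (Q? ∘ suc) N qN
... | c , qc , c-least = suc c , qc , λ { zero q0 → contradiction q0 ¬q0 ; (suc d) qd → s≤s (c-least d qd) }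

-- Descent along the lower central series

module LowerCentralSeries (K : FiniteField) (p : ℕ) (prime : Prime p) (P′ l : ℕ)
  (size≡ : FiniteField.size K ≡ p ℕ.^ (suc P′ ℕ.* l))
  (p∣PCj : ∀ j → 0 < j → j < suc P′ → p ∣ suc P′ C j) where

  open Semilinear K p prime P′ l size≡ p∣PCj public

  -- An `Elem` carries an arbitrary matrix and is compared up to `≃`, so a property of coordinates
  -- is asserted of some representative.
  Covered : (Coord → Set) → Elem → Set
  Covered Q z = Σ Coord λ x → Q x × z ≃ emb x

  record IsSubgroup (Q : Coord → Set) : Set where
    field
      Q-ε : Q ε
      Q-∙ : ∀ {x y} → Q x → Q y → Q (x ∙ y)
      Q-⁻ : ∀ {x} → Q x → Q (x ⁻)

  Gen⊆Covered : ∀ {Q : Coord → Set} {S : Elem → Set} → IsSubgroup Q → (∀ {z} → S z → Covered Q z) → ∀ {z} → Gen S z → Covered Q z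
  Gen⊆Covered {Q} {S} subgroup S⊆Q = go
    where
    open IsSubgroup subgroup
    go : ∀ {z} → Gen S z → Covered Q z
    go (gen s) = S⊆Q s
    go unit = ε , Q-ε , ≃-sym emb-ε
    go (mul gx gy) with go gx | go gy
    ... | x , qx , ex | y , qy , ey = x ∙ y , Q-∙ qx qy , ≃-trans (∘ₑ-cong ex ey) (emb-∙ x y)
    go (inv {x} {y} gx xy≈1) with go gx
    ... | x′ , qx , ex = x′ ⁻ ∙ ε , Q-∙ (Q-⁻ qx) Q-ε ,
      solve-emb x′ ε (≃-trans (∘ₑ-congʳ y (≃-sym ex)) (≃-trans (mk xy≈1) (≃-sym emb-ε)))
    go (resp gx x≈y) with go gx
    ... | x , qx , ex = x , qx , ≃-trans (≃-sym (mk x≈y)) ex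

  γ-step : ∀ {G : Elem → Set} {Q R Q′ : Coord → Set} s → IsSubgroup Q′ →
    (∀ {z} → γ G (suc s) z → Covered Q z) → (∀ {z} → G z → Covered R z) →
    (∀ x y → Q x → R y → Q′ (comm x y)) → ∀ {z} → γ G (suc (suc s)) z → Covered Q′ z
  γ-step s subgroup γ⊆Q G⊆R [Q,R]⊆Q′ = Gen⊆Covered subgroup λ (x , y , γx , Gy , c) →
    let (x′ , qx , ex) = γ⊆Q γx ; (y′ , ry , ey) = G⊆R Gy
    in comm x′ y′ , [Q,R]⊆Q′ x′ y′ qx ry , comm-unique x′ y′ ex ey c

  -- The index is written j + s so that raising j computes to the next term of the series.
  γ-chain : ∀ {G : Elem → Set} {R : Coord → Set} (X : ℕ → Coord → Set) → (∀ j → IsSubgroup (X j)) →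
    (∀ {z} → G z → Covered R z) → (∀ j x y → X j x → R y → X (suc j) (comm x y)) →
    ∀ s → (∀ {z} → γ G (suc s) z → Covered (X 0) z) → ∀ j {z} → γ G (suc (j ℕ.+ s)) z → Covered (X j) z
  γ-chain X subgroup G⊆R step s start zero = start
  γ-chain X subgroup G⊆R step s start (suc j) =
    γ-step (j ℕ.+ s) (subgroup (suc j)) (γ-chain X subgroup G⊆R step s start j) G⊆R (step j)

  -- Upper bound

  Id : ℕ → Set
  Id k = ∀ w → φ k w ≡ w

  φ-injective : ∀ k {x y} → φ k x ≡ φ k y → x ≡ y
  φ-injective k {x} {y} e = trans (sym (ψφ x)) (trans (cong (φ (P′ ℕ.* k)) e) (ψφ y))
    where
    ψφ : ∀ w → φ (P′ ℕ.* k) (φ k w) ≡ w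
    ψφ w = trans (φ-φ (P′ ℕ.* k) k w) (φ-inverseˡ k w)

  Id-+ : ∀ {j k} → Id j → Id k → Id (j ℕ.+ k)
  Id-+ {j} {k} ij ik w = trans (sym (φ-φ j k w)) (trans (ij _) (ik w))

  Id-P′* : ∀ {k} → Id k → Id (P′ ℕ.* k)
  Id-P′* {k} ik w = trans (cong (φ (P′ ℕ.* k)) (sym (ik w))) (trans (φ-φ (P′ ℕ.* k) k w) (φ-inverseˡ k w))

  module _ (x y : Coord) where
    open Coord x using () renaming (a to ax; b to bx; c to cx; t to tx; k to kx)
    open Coord y using () renaming (a to ay; b to by; c to cy; t to ty; k to ky)
    open Coord (comm x y) using () renaming (a to az; b to bz; c to cz; t to tz; k to kz)
    open _≋_ (y∙x∙comm x y)
    open ≡-Reasoning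

    -- Powers of g commute, so x y and y x carry the same automorphism.
    comm-Id : Id kz
    comm-Id w = φ-injective (ky ℕ.+ kx) (begin
      φ (ky ℕ.+ kx) (φ kz w) ≡⟨ φ-φ (ky ℕ.+ kx) kz w ⟩
      φ (ky ℕ.+ kx ℕ.+ kz) w ≡⟨ k≡ w ⟩
      φ (kx ℕ.+ ky) w ≡⟨ cong (λ m → φ m w) (ℕ.+-comm kx ky) ⟩
      φ (ky ℕ.+ kx) w ∎)

    private
      -- c and t multiply by φ u + v, without cross terms, so y x z = x y becomes a linear equation
      -- for z once `comm-Id` removes its twist.
      twisted : ∀ {u v w u′ v′} → φ kz (u + v) + w ≡ u′ + v′ → w ≡ (u′ - v) - (u - v′)
      twisted {u} {v} {w} {u′} {v′} e = begin
        w ≡⟨ solve 3 (λ u v w → w := (u :+ v :+ w) :- v :- u) refl u v w ⟩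
        (u + v + w) - v - u ≡⟨ cong (λ s → s - v - u) (trans (cong (_+ w) (sym (comm-Id (u + v)))) e) ⟩
        (u′ + v′) - v - u ≡⟨ solve 4 (λ u v u′ v′ → (u′ :+ v′) :- v :- u := (u′ :- v) :- (u :- v′)) refl u v u′ v′ ⟩
        (u′ - v) - (u - v′) ∎

    comm-c : cz ≡ (φ ky cx - cx) - (φ kx cy - cy)
    comm-c = twisted c≡

    comm-t : tz ≡ (φ ky tx - tx) - (φ kx ty - ty)
    comm-t = twisted t≡

    Im-comm-c : Im 1 cz
    Im-comm-c = subst (Im 1) (sym comm-c) (Im-+ 1 (Im-commutator 0 ky (Im-zero cx)) (Im-neg 1 (Im-commutator 0 kx (Im-zero cy))))

    Im-comm-t : Im 1 tz
    Im-comm-t = subst (Im 1) (sym comm-t) (Im-+ 1 (Im-commutator 0 ky (Im-zero tx)) (Im-neg 1 (Im-commutator 0 kx (Im-zero ty))))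

    module _ (ikx : Id kx) where
      private
        drop : ∀ {u v w} → w ≡ u - (φ kx v - v) → w ≡ u
        drop {u} {v} e = trans e (trans (cong (λ s → u - (s - v)) (ikx v)) (solve 2 (λ u v → u :- (v :- v) := u) refl u v))

      comm-c-Id : cz ≡ φ ky cx - cx
      comm-c-Id = drop comm-c

      comm-t-Id : tz ≡ φ ky tx - tx
      comm-t-Id = drop comm-t

      comm-0 : ∀ {u w} → w ≡ φ ky u - u → u ≡ 0# → w ≡ 0#
      comm-0 e refl = trans e (x≡y⇒x-y≡0 (frob-0 (l ℕ.* ky)))

      module _ (cx≡0 : cx ≡ 0#) (tx≡0 : tx ≡ 0#) where
        cz≡0 : cz ≡ 0#
        cz≡0 = comm-0 comm-c-Id cx≡0

        tz≡0 : tz ≡ 0#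
        tz≡0 = comm-0 comm-t-Id tx≡0

        -- With c and t of x equal to zero, the cross terms of the b-coordinate disappear, and b
        -- follows the rule that held for c.
        comm-b : bz ≡ φ ky bx - bx
        comm-b = begin
          bz ≡⟨ solve 4 (λ by bx bz r → bz := (by :+ bx :+ r :* con (0 , 0)) :+ bz :- by :- bx) refl by bx bz cy ⟩
          (by + bx + cy * 0#) + bz - by - bx ≡⟨ cong (λ s → s + bz - by - bx) yx ⟨
          φ kz byx + bz - by - bx ≡⟨ cong (λ s → s - by - bx) (trans (sym (trans (cong (λ s → φ kz byx + bz + φ kz (φ kx cy + cx) * s) tz≡0)
            (solve 2 (λ u v → u :+ v :* con (0 , 0) := u) refl (φ kz byx + bz) (φ kz (φ kx cy + cx))))) b≡) ⟩
          (φ ky bx + by + φ ky cx * ty) - by - bx ≡⟨ cong (λ s → (φ ky bx + by + s * ty) - by - bx) (trans (cong (φ ky) cx≡0) (frob-0 (l ℕ.* ky))) ⟩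
          (φ ky bx + by + 0# * ty) - by - bx ≡⟨ solve 4 (λ u by t bx → (u :+ by :+ con (0 , 0) :* t) :- by :- bx := u :- bx) refl (φ ky bx) by ty bx ⟩
          φ ky bx - bx ∎
          where
          byx = φ kx by + bx + φ kx cy * tx
          yx : φ kz byx ≡ by + bx + cy * 0#
          yx = trans (comm-Id byx) (cong₂ (λ s r → s + r) (cong (_+ bx) (ikx by)) (cong₂ _*_ (ikx cy) tx≡0))

        module _ (bx≡0 : bx ≡ 0#) where
          bz≡0 : bz ≡ 0#
          bz≡0 = comm-0 comm-b bx≡0

          -- Every cross term of the a-coordinate now contains a vanishing b, c or t of x, or a
          -- vanishing b or c of the commutator.
          comm-a : az ≡ φ ky ax - ax
          comm-a = begin
            az ≡⟨ solve 3 (λ ay ax az → az := (ay :+ ax) :+ az :- ay :- ax) refl ay ax az ⟩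
            (ay + ax) + az - ay - ax ≡⟨ cong (λ s → s + az - ay - ax) yx ⟨
            φ kz ayx + az - ay - ax ≡⟨ cong (λ s → s - ay - ax) (trans (sym lhs) a≡) ⟩
            (φ ky ax + ay - φ ky bx * cy + φ ky cx * (by - cy * ty)) - ay - ax
              ≡⟨ cong₂ (λ s r → (φ ky ax + ay - s * cy + r * (by - cy * ty)) - ay - ax) (φ0 bx≡0) (φ0 cx≡0) ⟩
            (φ ky ax + ay - 0# * cy + 0# * (by - cy * ty)) - ay - ax
              ≡⟨ solve 5 (λ u ay c r ax → (u :+ ay :- con (0 , 0) :* c :+ con (0 , 0) :* r) :- ay :- ax := u :- ax) refl (φ ky ax) ay cy (by - cy * ty) ax ⟩
            φ ky ax - ax ∎
            where
            φ0 : ∀ {u} → u ≡ 0# → φ ky u ≡ 0#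
            φ0 refl = frob-0 (l ℕ.* ky)
            ayx byx cyx : F
            ayx = φ kx ay + ax - φ kx by * cx + φ kx cy * (bx - cx * tx)
            byx = φ kx by + bx + φ kx cy * tx
            cyx = φ kx cy + cx
            yx : φ kz ayx ≡ ay + ax
            yx = trans (comm-Id ayx) (trans (cong₂ (λ c b → φ kx ay + ax - φ kx by * c + φ kx cy * (b - c * tx)) cx≡0 bx≡0)
              (trans (solve 5 (λ u ax v w t → u :+ ax :- v :* con (0 , 0) :+ w :* (con (0 , 0) :- con (0 , 0) :* t) := u :+ ax) refl (φ kx ay) ax (φ kx by) (φ kx cy) tx)
                (cong (_+ ax) (ikx ay))))
            lhs : φ kz ayx + az - φ kz byx * cz + φ kz cyx * (bz - cz * tz) ≡ φ kz ayx + az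
            lhs = trans (cong₂ (λ c b → φ kz ayx + az - φ kz byx * c + φ kz cyx * (b - c * tz)) cz≡0 bz≡0)
              (solve 4 (λ u v w t → u :- v :* con (0 , 0) :+ w :* (con (0 , 0) :- con (0 , 0) :* t) := u) refl (φ kz ayx + az) (φ kz byx) (φ kz cyx) tz)

  -- The three phases: c and t, then b, then a move down the filtration. `X₁` starts at index 1
  -- because the commutators of G already lie in the image of D there.
  X₁ X₂ X₃ : ℕ → Coord → Set
  X₁ j (coord a b c t k) = Id k × Im (suc j) c × Im (suc j) t
  X₂ j (coord a b c t k) = Id k × c ≡ 0# × t ≡ 0# × Im j b
  X₃ j (coord a b c t k) = Id k × c ≡ 0# × t ≡ 0# × b ≡ 0# × Im j a

  private
    φ≡0 : ∀ k {u} → u ≡ 0# → φ k u ≡ 0#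
    φ≡0 k refl = frob-0 (l ℕ.* k)

    +≡0 : ∀ k {u v} → u ≡ 0# → v ≡ 0# → φ k u + v ≡ 0#
    +≡0 k {u} u≡0 refl = trans (+-identityʳ _) (φ≡0 k u≡0)

    -≡0 : ∀ k {u} → u ≡ 0# → - φ k u ≡ 0#
    -≡0 k u≡0 = trans (cong -_ (φ≡0 k u≡0)) -0#≈0#

  X₁-subgroup : ∀ j → IsSubgroup (X₁ j)
  X₁-subgroup j = record
    { Q-ε = φ-zero , Im-0# (suc j) refl , Im-0# (suc j) refl
    ; Q-∙ = λ {(coord _ _ _ _ k)} {(coord _ _ _ _ k′)} (ik , ic , it) (ik′ , ic′ , it′) →
        Id-+ {k} {k′} ik ik′ , Im-+ (suc j) (Im-frob (suc j) (l ℕ.* k′) ic) ic′ , Im-+ (suc j) (Im-frob (suc j) (l ℕ.* k′) it) it′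
    ; Q-⁻ = λ {(coord _ _ _ _ k)} (ik , ic , it) →
        Id-P′* {k} ik , Im-neg (suc j) (Im-frob (suc j) (l ℕ.* (P′ ℕ.* k)) ic) , Im-neg (suc j) (Im-frob (suc j) (l ℕ.* (P′ ℕ.* k)) it)
    }

  X₂-subgroup : ∀ j → IsSubgroup (X₂ j)
  X₂-subgroup j = record
    { Q-ε = φ-zero , refl , refl , Im-0# j refl
    ; Q-∙ = λ {(coord _ b c _ k)} {(coord _ b′ _ t′ k′)} (ik , c≡0 , t≡0 , ib) (ik′ , c′≡0 , t′≡0 , ib′) →
        Id-+ {k} {k′} ik ik′ , +≡0 k′ c≡0 c′≡0 , +≡0 k′ t≡0 t′≡0 ,
        Im-+ j (Im-+ j (Im-frob j (l ℕ.* k′) ib) ib′) (Im-0# j (trans (cong (φ k′ c *_) t′≡0) (zeroʳ _)))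
    ; Q-⁻ = λ {(coord _ b c t k)} (ik , c≡0 , t≡0 , ib) →
        Id-P′* {k} ik , -≡0 (P′ ℕ.* k) c≡0 , -≡0 (P′ ℕ.* k) t≡0 ,
        Im-+ j (Im-0# j (trans (cong (φ (P′ ℕ.* k) c *_) (φ≡0 (P′ ℕ.* k) t≡0)) (zeroʳ _))) (Im-neg j (Im-frob j (l ℕ.* (P′ ℕ.* k)) ib))
    }

  X₃-subgroup : ∀ j → IsSubgroup (X₃ j)
  X₃-subgroup j = record
    { Q-ε = φ-zero , refl , refl , refl , Im-0# j refl
    ; Q-∙ = λ {(coord a b c _ k)} {(coord a′ b′ c′ t′ k′)} (ik , c≡0 , t≡0 , b≡0 , ia) (ik′ , c′≡0 , t′≡0 , b′≡0 , ia′) →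
        Id-+ {k} {k′} ik ik′ , +≡0 k′ c≡0 c′≡0 , +≡0 k′ t≡0 t′≡0 ,
        trans (cong₂ _+_ (+≡0 k′ b≡0 b′≡0) (trans (cong (φ k′ c *_) t′≡0) (zeroʳ _))) (+-identityʳ 0#) ,
        Im-+ j (Im-+ j (Im-+ j (Im-frob j (l ℕ.* k′) ia) ia′)
          (Im-neg j (Im-0# j (trans (cong (φ k′ b *_) c′≡0) (zeroʳ _)))))
          (Im-0# j (trans (cong (_* (b′ - c′ * t′)) (φ≡0 k′ c≡0)) (zeroˡ _)))
    ; Q-⁻ = λ {(coord a b c t k)} (ik , c≡0 , t≡0 , b≡0 , ia) →
        Id-P′* {k} ik , -≡0 (P′ ℕ.* k) c≡0 , -≡0 (P′ ℕ.* k) t≡0 ,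
        trans (cong₂ _+_ (trans (cong (φ (P′ ℕ.* k) c *_) (φ≡0 (P′ ℕ.* k) t≡0)) (zeroʳ _)) (-≡0 (P′ ℕ.* k) b≡0)) (+-identityʳ 0#) ,
        Im-neg j (Im-frob j (l ℕ.* (P′ ℕ.* k)) ia)
    }

  γ-trivial : ∀ {G : Elem → Set} → (∀ {z} → G z → Covered (λ _ → ⊤) z) → Trivial (γ G (suc (3 ℕ.* P)))
  γ-trivial {G} G⊆ z γz = un (≃-trans (proj₂ (proj₂ last)) (≃-trans (emb-cong (trivial (proj₁ last) (proj₁ (proj₂ last)))) emb-ε))
    where
    γ₂⊆X₁ : ∀ {z} → γ G 2 z → Covered (X₁ 0) z
    γ₂⊆X₁ = γ-step 0 (X₁-subgroup 0) G⊆ G⊆ (λ x y _ _ → comm-Id x y , Im-comm-c x y , Im-comm-t x y)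

    -- γ_2 is at index 1 of the filtration, so P - 1 further steps reach index P, where c and t are
    -- 0.
    chain₁ : ∀ {z} → γ G (suc (P′ ℕ.+ 1)) z → Covered (X₁ P′) z
    chain₁ = γ-chain X₁ X₁-subgroup G⊆ (λ j x y (ik , ic , it) _ → comm-Id x y ,
      subst (Im (suc (suc j))) (sym (comm-c-Id x y ik)) (Im-commutator (suc j) (Coord.k y) ic) ,
      subst (Im (suc (suc j))) (sym (comm-t-Id x y ik)) (Im-commutator (suc j) (Coord.k y) it)) 1 γ₂⊆X₁ P′

    chain₂ : ∀ {z} → γ G (suc (P ℕ.+ (P′ ℕ.+ 1))) z → Covered (X₂ P) z
    chain₂ = γ-chain X₂ X₂-subgroup G⊆ (λ j x y (ik , c≡0 , t≡0 , ib) _ → comm-Id x y , cz≡0 x y ik c≡0 t≡0 , tz≡0 x y ik c≡0 t≡0 ,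
      subst (Im (suc j)) (sym (comm-b x y ik c≡0 t≡0)) (Im-commutator j (Coord.k y) ib)) (P′ ℕ.+ 1)
      -- The phase for c and t ends with `Im-P`; the phase for b starts from the vacuous index 0,
      -- and likewise for a afterwards.
      (λ γz → let (x , (ik , ic , it) , e) = chain₁ γz in x , (ik , Im-P ic , Im-P it , Im-zero _) , e) P

    chain₃ : ∀ {z} → γ G (suc (P ℕ.+ (P ℕ.+ (P′ ℕ.+ 1)))) z → Covered (X₃ P) z
    chain₃ = γ-chain X₃ X₃-subgroup G⊆ (λ j x y (ik , c≡0 , t≡0 , b≡0 , ia) _ → comm-Id x y , cz≡0 x y ik c≡0 t≡0 , tz≡0 x y ik c≡0 t≡0 ,
      bz≡0 x y ik c≡0 t≡0 b≡0 ,
      subst (Im (suc j)) (sym (comm-a x y ik c≡0 t≡0 b≡0)) (Im-commutator j (Coord.k y) ia)) (P ℕ.+ (P′ ℕ.+ 1))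
      (λ γz → let (x , (ik , c≡0 , t≡0 , ib) , e) = chain₂ γz in x , (ik , c≡0 , t≡0 , Im-P ib , Im-zero _) , e) P

    last : Covered (X₃ P) z
    last = chain₃ (subst (λ m → γ G (suc (P ℕ.+ (P ℕ.+ m))) z) (trans (ℕ.+-identityʳ P) (ℕ.+-comm 1 P′)) γz)

    trivial : ∀ x → X₃ P x → x ≋ ε
    trivial x (ik , c≡0 , t≡0 , b≡0 , ia) = mk≋ (Im-P ia) b≡0 c≡0 t≡0 (λ w → trans (ik w) (sym (φ-zero w)))

-- Iterated commutators, decidability of triviality, generating lists

module NilpotencyBounds (K : FiniteField) (p : ℕ) (prime : Prime p) (P′ l : ℕ)
  (size≡ : FiniteField.size K ≡ p ℕ.^ (suc P′ ℕ.* l))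
  (p∣PCj : ∀ j → 0 < j → j < suc P′ → p ∣ suc P′ C j) where

  open LowerCentralSeries K p prime P′ l size≡ p∣PCj public

  -- Lower bound

  module LowerBound (p≢2 : p ≢ 2) (G : Elem → Set)
    (b : F) (Trb≢0 : Tr b ≢ 0#) (Gb : G (emb (coord 0# b 0# 0# 0)))
    (x y z t : F) (Trz≢0 : Tr z ≢ 0#) (Gh : G (emb (coord x y z t 1))) where

    h : Coord
    h = coord x y z t 1

    -- The coordinates of the i-fold commutator with h. One z g(B i) comes from v h; the other comes
    -- from h v as z (B i + D (B i)).
    A B : ℕ → F
    A zero = 0#
    A (suc i) = D (A i) - ι 2 * (z * g (B i))
    B i = iterate D i b

    v : ℕ → Coord
    v i = coord (A i) (B i) 0# 0# 0

    φ-one : ∀ w → φ 1 w ≡ g w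
    φ-one w = cong (λ m → frob m w) (ℕ.*-identityʳ l)

    ∙-abelian : ∀ a b c t k a′ b′ → coord a b c t k ∙ coord a′ b′ 0# 0# 0 ≋ coord (a + a′ + c * b′) (b + b′) c t k
    ∙-abelian a b c t k a′ b′ = mk≋
      (trans (cong₂ (λ u w → u + a′ - φ 0 b * 0# + w * (b′ - 0# * 0#)) (φ-zero a) (φ-zero c))
        (solve 5 (λ a a′ b c b′ → a :+ a′ :- b :* e0 :+ c :* (b′ :- e0 :* e0) := a :+ a′ :+ c :* b′) refl a a′ (φ 0 b) c b′))
      (trans (cong (λ u → u + b′ + φ 0 c * 0#) (φ-zero b)) (solve 3 (λ b b′ c → b :+ b′ :+ c :* e0 := b :+ b′) refl b b′ (φ 0 c)))
      (trans (+-identityʳ _) (φ-zero c))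
      (trans (+-identityʳ _) (φ-zero t))
      (λ w → cong (λ m → φ m w) (ℕ.+-identityʳ k))
      where
      e0 : ∀ {m} → Polynomial m
      e0 = con (0 , 0)

    abelian-∙ : ∀ a b → coord a b 0# 0# 0 ∙ h ≋ coord (g a + x - g b * z) (g b + y) z t 1
    abelian-∙ a b = mk≋
      (trans (cong₂ (λ u w → u + x - w * z + φ 1 0# * (y - z * t)) (φ-one a) (φ-one b))
        (trans (cong (λ u → g a + x - g b * z + u * (y - z * t)) φ0) (trans (cong (g a + x - g b * z +_) (zeroˡ _)) (+-identityʳ _))))
      (trans (cong₂ (λ u w → u + y + w * t) (φ-one b) φ0) (trans (cong (g b + y +_) (zeroˡ t)) (+-identityʳ _)))
      (trans (cong (_+ z) φ0) (+-identityˡ z))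
      (trans (cong (_+ t) φ0) (+-identityˡ t))
      (λ _ → refl)
      where
      φ0 : φ 1 0# ≡ 0#
      φ0 = frob-0 (l ℕ.* 1)

    v-comm : ∀ i → h ∙ v i ∙ v (suc i) ≋ v i ∙ h
    v-comm i = ≋-trans (∙-congʳ (v (suc i)) (∙-abelian x y z t 1 (A i) (B i)))
      (≋-trans (∙-abelian (x + A i + z * B i) (y + B i) z t 1 (A (suc i)) (B (suc i)))
      (≋-trans (mk≋
        (solve 6 (λ x a z b ga gb → x :+ a :+ z :* b :+ ((ga :- a) :- (e1 :+ (e1 :+ e0)) :* (z :* gb)) :+ z :* (gb :- b) := ga :+ x :- gb :* z) refl x (A i) z (B i) (g (A i)) (g (B i)))
        (solve 3 (λ y b gb → y :+ b :+ (gb :- b) := gb :+ y) refl y (B i) (g (B i)))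
        refl refl (λ _ → refl))
      (≋-sym (abelian-∙ (A i) (B i)))))
      where
      e0 e1 : ∀ {m} → Polynomial m
      e0 = con (0 , 0)
      e1 = con (1 , 0)

    v-γ : ∀ i → γ G (suc i) (emb (v i))
    v-γ zero = Gb
    v-γ (suc i) = gen (emb (v i) , emb h , v-γ i , Gh , isComm-emb (v i) h (v-comm i))

    B-vanishes : ∀ j → B (j ℕ.+ P) ≡ 0#
    B-vanishes zero = D^P≡0 b
    B-vanishes (suc j) = trans (cong D (B-vanishes j)) D-0

    A-step : ∀ i → B i ≡ 0# → A (suc i) ≡ D (A i)
    A-step i Bi≡0 = trans (cong (λ u → D (A i) - ι 2 * (z * u)) (trans (cong g Bi≡0) (frob-0 l)))
      (solve 3 (λ d m z → d :- m :* (z :* con (0 , 0)) := d) refl (D (A i)) (ι 2) z)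

    A-tail : ∀ j → A (j ℕ.+ P) ≡ iterate D j (A P)
    A-tail zero = refl
    A-tail (suc j) = trans (A-step (j ℕ.+ P) (B-vanishes j)) (cong D (A-tail j))

    -- Whatever `A P′` is, D^(P - 1) sends D of it to 0, so only the last cross term counts; its
    -- coefficient 2 Tr(b) is fixed by g and passes through D^(P - 1).
    A-last : A (P′ ℕ.+ P) ≡ - (ι 2 * Tr b * Tr z)
    A-last = begin
      A (P′ ℕ.+ P) ≡⟨ A-tail P′ ⟩
      iterate D P′ (D (A P′) - ι 2 * (z * g (Tr b))) ≡⟨ cong (λ u → iterate D P′ (D (A P′) - ι 2 * (z * u))) (Tr-InSub b) ⟩
      iterate D P′ (D (A P′) - ι 2 * (z * Tr b)) ≡⟨ iterate-+ P′ _ _ ⟩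
      iterate D P′ (D (A P′)) + iterate D P′ (- (ι 2 * (z * Tr b))) ≡⟨ cong₂ _+_ (trans (iterate-D-D P′ (A P′)) (D^P≡0 (A P′))) (iterate-D-neg P′ _) ⟩
      0# - iterate D P′ (ι 2 * (z * Tr b)) ≡⟨ +-identityˡ _ ⟩
      - iterate D P′ (ι 2 * (z * Tr b)) ≡⟨ cong (λ u → - iterate D P′ u) (solve 3 (λ m z b → m :* (z :* b) := m :* b :* z) refl (ι 2) z (Tr b)) ⟩
      - iterate D P′ (ι 2 * Tr b * z) ≡⟨ cong -_ (iterate-D-* P′ (InSub-* {l} (InSub-ι l 2) (Tr-InSub b)) z) ⟩
      - (ι 2 * Tr b * Tr z) ∎
      where open ≡-Reasoning

    A-last≢0 : A (P′ ℕ.+ P) ≢ 0#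
    A-last≢0 e = *-nonzero (*-nonzero (ι2≢0 p≢2) Trb≢0) Trz≢0 (begin
      w ≡⟨ solve 1 (λ w → w := :- (:- w)) refl w ⟩
      - (- w) ≡⟨ cong -_ (trans (sym A-last) e) ⟩
      - 0# ≡⟨ -0#≈0# ⟩
      0# ∎)
      where
      open ≡-Reasoning
      w = ι 2 * Tr b * Tr z

    -- Carries a trivial commutator at d < 2P forward to 2P - 1, where `A-last≢0` refutes it.
    stays-zero : ∀ d → A d ≡ 0# → B d ≡ 0# → ∀ j → A (j ℕ.+ d) ≡ 0# × B (j ℕ.+ d) ≡ 0#
    stays-zero d Ad Bd zero = Ad , Bd
    stays-zero d Ad Bd (suc j) with stays-zero d Ad Bd j
    ... | Aj , Bj = trans (A-step (j ℕ.+ d) Bj) (trans (cong D Aj) D-0) , trans (cong D Bj) D-0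

    bound : ∀ d → Trivial (γ G (suc d)) → 2 ℕ.* P ≤ d
    bound d triv with 2 ℕ.* P ℕ.≤? d
    ... | yes 2P≤d = 2P≤d
    ... | no 2P≰d = contradiction (subst (λ m → A m ≡ 0#) reach (proj₁ (stays-zero d (_≋_.a≡ v≋ε) (_≋_.b≡ v≋ε) (P′ ℕ.+ P ℕ.∸ d)))) A-last≢0
      where
      v≋ε : v d ≋ ε
      v≋ε = emb-injective (≃-trans (mk (triv (emb (v d)) (v-γ d))) (≃-sym emb-ε))
      2P≡ : 2 ℕ.* P ≡ suc (P′ ℕ.+ P)
      2P≡ = cong (P ℕ.+_) (ℕ.+-identityʳ P)
      reach : P′ ℕ.+ P ℕ.∸ d ℕ.+ d ≡ P′ ℕ.+ P
      reach = ℕ.m∸n+n≡m (ℕ.≤-pred (subst (d <_) 2P≡ (ℕ.≰⇒> 2P≰d)))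

  infix 4 _≋?_
  _≋?_ : ∀ x y → Dec (x ≋ y)
  x ≋? y = Dec.map′ (λ (a , b , c , t , k) → mk≋ a b c t k) (λ (mk≋ a b c t k) → a , b , c , t , k)
    (a x ≟ a y ×-dec b x ≟ b y ×-dec c x ≟ c y ×-dec t x ≟ t y ×-dec all? (λ w → φ (k x) w ≟ φ (k y) w))
    where open Coord

  -- G is squeezed between a finite list and the subgroup generated by it, which makes its central
  -- series computable from the list.
  module FiniteGeneration (G : Elem → Set) (L : List Coord) (L⊆G : ∀ {x} → x ∈ L → G (emb x))
    (G⊆L : ∀ {z} → G z → Covered (UpperCentralSeries.Generated ambient L) z) where
    open UpperCentralSeries ambient L

    -- Each commutator with a member of L raises the γ-index j and lowers the central index i,
    -- keeping i + j = d.
    trivial⇒central : ∀ d → Trivial (γ G (suc d)) → ∀ i j → i ℕ.+ j ≡ d → ∀ x → γ G (suc j) (emb x) → Central i x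
    trivial⇒central d triv zero j refl x γx = emb-injective (≃-trans (mk (triv (emb x) γx)) (≃-sym emb-ε))
    trivial⇒central d triv (suc i) j eq x γx = All.tabulate (λ {y} y∈L →
      trivial⇒central d triv i (suc j) (trans (ℕ.+-suc i j) eq) (comm x y)
        (gen (emb x , emb y , γx , L⊆G y∈L , isComm-emb x y (y∙x∙comm x y))))

    Z-subgroup : ∀ i → IsSubgroup (Z i)
    Z-subgroup i = record { Q-ε = Q-ε ; Q-∙ = Q-∙ ; Q-⁻ = Q-⁻¹ }
      where open IsNormal (Z-normal i)

    central⇒trivial : ∀ d → All (Central d) L → Trivial (γ G (suc d))
    central⇒trivial d cL z γz = let (x , (_ , x≋ε) , e) = γ⊆Z d 0 refl γz in un (≃-trans e (≃-trans (emb-cong x≋ε) emb-ε))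
      where
      γ⊆Z : ∀ j i → i ℕ.+ j ≡ d → ∀ {z} → γ G (suc j) z → Covered (Z i) z
      γ⊆Z zero i eq Gz = let (x , sx , e) = G⊆L Gz in x , generated⊆Z i (subst (λ m → All (Central m) L) (trans (sym eq) (ℕ.+-identityʳ i)) cL) sx , e
      γ⊆Z (suc j) i eq = γ-step j (Z-subgroup i) (γ⊆Z j (suc i) (trans (sym (ℕ.+-suc i j)) eq)) G⊆L (λ x y zx sy → Z-[] {i} (Z-normal i) zx sy)

    trivial? : ∀ d → Dec (Trivial (γ G (suc d)))
    trivial? d = Dec.map′ (central⇒trivial d)
      (λ triv → All.tabulate (λ {x} x∈L → trivial⇒central d triv d 0 (ℕ.+-identityʳ d) x (L⊆G x∈L)))
      (All.all? (central? _≋?_ d) L)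

    class : (∀ d → Trivial (γ G (suc d)) → 2 ℕ.* P ≤ d) → Σ ℕ λ c → NilpotencyClass G c × 2 ℕ.* P ≤ c × c ≤ 3 ℕ.* P
    class lower = proj₁ search , proj₂ search , lower (proj₁ search) (proj₁ (proj₂ search)) , proj₂ (proj₂ search) (3 ℕ.* P) upper
      where
      upper : Trivial (γ G (suc (3 ℕ.* P)))
      upper = γ-trivial (λ Gz → let (x , _ , e) = G⊆L Gz in x , tt , e)
      search : Σ ℕ (NilpotencyClass G)
      search = least trivial? (3 ℕ.* P) upper

  -- The families g_{a,b,c} with θ_{a,b,c} = (g^m)^k, where k is only determined modulo p.
  module Family (m : ℕ) (mp≡P : m ℕ.* p ≡ P) (S : F → F)
    (Cond : F → F → F → F → Set) (cond? : ∀ a b c e → Dec (Cond a b c e)) where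

    elements : List F
    elements = map fromFin (allFin size)

    ∈-elements : ∀ x → x ∈ elements
    ∈-elements x = subst (_∈ elements) (fromFin-toFin x) (∈-map⁺ fromFin (∈-allFin (toFin x)))

    member : F × F × F × ℕ → Coord
    member (a , b , c , k) = coord a b c (S c) (m ℕ.* k)

    parameters : List (F × F × F × ℕ)
    parameters = cartesianProduct elements (cartesianProduct elements (cartesianProduct elements (upTo p)))

    members : List Coord
    members = map member (filter (λ (a , b , c , k) → cond? a b c (ι k)) parameters)

    members⁻ : ∀ {x} → x ∈ members → Σ (F × F × F × ℕ) λ (a , b , c , k) → Cond a b c (ι k) × x ≡ coord a b c (S c) (m ℕ.* k)
    members⁻ x∈ with ∈-map⁻ member x∈
    ... | q , q∈ , eq = q , proj₂ (∈-filter⁻ (λ (a , b , c , k) → cond? a b c (ι k)) {xs = parameters} q∈) , eq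

    -- Reducing k modulo p changes neither `ι k`, as `ι p` = 0, nor g^(mk), as g^(mp) = g^P = 1. The
    -- exponent r is free because the constructions bracket it differently.
    members⁺ : ∀ a b c k → Cond a b c (ι k) → ∀ {r} → r ≡ l ℕ.* (m ℕ.* k) → Covered (_∈ members) (E a b c (S c) , r)
    members⁺ a b c k cond refl = member (a , b , c , k′) , ∈-map⁺ member (∈-filter⁺ _
        (∈-cartesianProduct⁺ (∈-elements a) (∈-cartesianProduct⁺ (∈-elements b) (∈-cartesianProduct⁺ (∈-elements c) (∈-upTo⁺ (m%n<n k p)))))
        (subst (Cond a b c) ι≡ cond)) ,
      mk ((λ _ _ → refl) , φ≡)
      where
      instance
        p≢0 : NonZero p
        p≢0 = prime⇒nonZero prime
      open ≡-Reasoning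
      k′ q : ℕ
      k′ = k ℕ.% p
      q = k ℕ./ p
      ι≡ : ι k ≡ ι k′
      ι≡ = begin
        ι k ≡⟨ cong ι (m≡m%n+[m/n]*n k p) ⟩
        ι (k′ ℕ.+ q ℕ.* p) ≡⟨ ι-+ k′ (q ℕ.* p) ⟩
        ι k′ + ι (q ℕ.* p) ≡⟨ cong (ι k′ +_) (ι-∣ ιp≡0 (divides q refl)) ⟩
        ι k′ + 0# ≡⟨ +-identityʳ _ ⟩
        ι k′ ∎
      φ≡ : ∀ w → φ (m ℕ.* k) w ≡ φ (m ℕ.* k′) w
      φ≡ w = begin
        φ (m ℕ.* k) w ≡⟨ cong (λ i → φ (m ℕ.* i) w) (m≡m%n+[m/n]*n k p) ⟩
        φ (m ℕ.* (k′ ℕ.+ q ℕ.* p)) w ≡⟨ cong (λ i → φ i w) (trans (ℕ.*-distribˡ-+ m k′ (q ℕ.* p)) (cong (m ℕ.* k′ ℕ.+_)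
          (trans (cong (m ℕ.*_) (ℕ.*-comm q p)) (trans (sym (ℕ.*-assoc m p q)) (cong (ℕ._* q) mp≡P))))) ⟩
        φ (m ℕ.* k′ ℕ.+ P ℕ.* q) w ≡⟨ φ-φ (m ℕ.* k′) (P ℕ.* q) w ⟨
        φ (m ℕ.* k′) (φ (P ℕ.* q) w) ≡⟨ cong (φ (m ℕ.* k′)) (frob-lP q w) ⟩
        φ (m ℕ.* k′) w ∎

  linPoly-0 : ∀ s → linPoly n s 0# ≡ 0#
  linPoly-0 s = Σ<-zero n _ (λ i _ → trans (cong (s i *_) (frob-0 i)) (zeroʳ _))

  QC-0 : ∀ s μ → QC n s μ 0# ≡ 0#
  QC-0 s μ = trans (cong (λ u → - tr n u) (solve 2 (λ μ y → μ :* con (0 , 0) :* y := con (0 , 0)) refl μ (linPoly n s 0#)))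
    (trans (cong -_ tr-0) -0#≈0#)

-- The three constructions

constructionB : (K : FiniteField) (p l : ℕ) → Prime p → p ≢ 2 → 1 < l → FiniteField.size K ≡ p ℕ.^ (p ℕ.* l) →
  let open FieldDefs K p in
  (s : ℕ → F) (μC : F) → InSub l μC → μC ≢ 0# →
  Σ ℕ λ c → NilpotencyClass (GroupB l s μC) c × 2 ℕ.* p ≤ c × c ≤ 3 ℕ.* p
constructionB K zero l pr = contradiction pr ¬prime[0]
constructionB K p@(suc p′) l pr p≢2 1<l size≡ s μC fμ μ≢0 = class bound
  where
  open NilpotencyBounds K p pr p′ l size≡ (prime∣pCj pr)
  S : F → F
  S = linPoly n s
  open Family 1 (ℕ.*-identityˡ p) S (λ a b c e → e ≡ tr n (μC * c)) (λ a b c e → e ≟ tr n (μC * c))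

  G : Elem → Set
  G = GroupB l s μC

  k≡1*k : ∀ k → l ℕ.* k ≡ l ℕ.* (1 ℕ.* k)
  k≡1*k k = cong (l ℕ.*_) (sym (ℕ.*-identityˡ k))

  L⊆G : ∀ {x} → x ∈ members → G (emb x)
  L⊆G x∈ with members⁻ x∈
  ... | (a , b , c , k) , cond , refl = a , b , c , k , cond , ((λ _ _ → refl) , λ w → cong (λ m → frob m w) (sym (k≡1*k k)))

  G⊆L : ∀ {z} → G z → Covered (UpperCentralSeries.Generated ambient members) z
  G⊆L (a , b , c , k , cond , z≈) = let (x , x∈ , e) = members⁺ a b c k cond (k≡1*k k) in x , UpperCentralSeries.gen x∈ , ≃-trans (mk z≈) e

  open FiniteGeneration G members L⊆G G⊆L

  b∃ : Σ F λ b → Tr b ≢ 0#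
  b∃ = ∃Tr≢0 1<l
  -- Trace 1 makes the automorphism of the element with c = z equal to g itself, and through `Tr≢0`
  -- it also gives Tr(z) ≠ 0.
  z∃ : Σ F λ z → tr n (μC * z) ≡ ι 1
  z∃ = tr-surjective (0<n 1<l) μ≢0 (InSub-ι 1 1)

  Gb : G (emb (coord 0# (proj₁ b∃) 0# 0# 0))
  Gb = 0# , proj₁ b∃ , 0# , 0 , sym (trans (cong (tr n) (zeroʳ μC)) tr-0) , un (emb-cong (mk≋ refl refl refl (sym (linPoly-0 s)) (λ _ → refl)))

  Gh : G (emb (coord 0# 0# (proj₁ z∃) (S (proj₁ z∃)) 1))
  Gh = 0# , 0# , proj₁ z∃ , 1 , sym (proj₂ z∃) , ((λ _ _ → refl) , λ _ → refl)

  bound : ∀ d → Trivial (γ G (suc d)) → 2 ℕ.* p ≤ d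
  bound = LowerBound.bound p≢2 G (proj₁ b∃) (proj₂ b∃) Gb 0# 0# (proj₁ z∃) (S (proj₁ z∃))
    (Tr≢0 fμ (λ e → 0≢1 (trans (sym e) (trans (proj₂ z∃) (+-identityʳ 1#))))) Gh

constructionC : (K : FiniteField) (p l : ℕ) → Prime p → p ≢ 2 → 1 < l → FiniteField.size K ≡ p ℕ.^ (p ℕ.* l) →
  let open FieldDefs K p in
  (μB : F) → InSub l μB → μB ≢ 0# → (s : ℕ → F) →
  Σ ℕ λ c → NilpotencyClass (GroupC l s μB) c × 2 ℕ.* p ≤ c × c ≤ 3 ℕ.* p
constructionC K zero l pr = contradiction pr ¬prime[0]
constructionC K p@(suc p′) l pr p≢2 1<l size≡ μB fμ μ≢0 s = class bound
  where
  open NilpotencyBounds K p pr p′ l size≡ (prime∣pCj pr)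
  S : F → F
  S = linPoly n s
  exponent : F → F → F
  exponent b c = ι 2 ⁻¹ * QC n s μB c + tr n (μB * b)
  open Family 1 (ℕ.*-identityˡ p) S (λ a b c e → e ≡ exponent b c) (λ a b c e → e ≟ exponent b c)

  G : Elem → Set
  G = GroupC l s μB

  k≡1*k : ∀ k → l ℕ.* k ≡ l ℕ.* (1 ℕ.* k)
  k≡1*k k = cong (l ℕ.*_) (sym (ℕ.*-identityˡ k))

  L⊆G : ∀ {x} → x ∈ members → G (emb x)
  L⊆G x∈ with members⁻ x∈
  ... | (a , b , c , k) , cond , refl = a , b , c , k , cond , ((λ _ _ → refl) , λ w → cong (λ m → frob m w) (sym (k≡1*k k)))

  G⊆L : ∀ {z} → G z → Covered (UpperCentralSeries.Generated ambient members) z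
  G⊆L (a , b , c , k , cond , z≈) = let (x , x∈ , e) = members⁺ a b c k cond (k≡1*k k) in x , UpperCentralSeries.gen x∈ , ≃-trans (mk z≈) e

  open FiniteGeneration G members L⊆G G⊆L

  b∃ : Σ F λ b → tr n (μB * b) ≡ 0# × Tr b ≢ 0#
  b∃ = ∃tr≡0∧Tr≢0 1<l μ≢0 fμ
  b : F
  b = proj₁ b∃
  z∃ : Σ F λ z → Tr z ≢ 0#
  z∃ = ∃Tr≢0 1<l
  z : F
  z = proj₁ z∃
  half-Q : F
  half-Q = ι 2 ⁻¹ * QC n s μB z
  -- z is chosen for its relative trace alone; y then corrects the exponent to 1, the required value
  -- 1 - Q(z)/2 being in F_p.
  y∃ : Σ F λ y → tr n (μB * y) ≡ ι 1 - half-Q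
  y∃ = tr-surjective (0<n 1<l) μ≢0 (InSub-- {1} (InSub-ι 1 1)
    (InSub-* {1} (InSub-inverse {1} (ι2≢0 p≢2) (InSub-ι 1 2)) (InSub-neg {1} (tr-InSub (μB * z * S z)))))
  y : F
  y = proj₁ y∃

  Gb : G (emb (coord 0# b 0# 0# 0))
  Gb = 0# , b , 0# , 0 , sym (trans (cong₂ (λ u v → ι 2 ⁻¹ * u + v) (QC-0 s μB) (proj₁ (proj₂ b∃))) (trans (+-identityʳ _) (zeroʳ _))) ,
    un (emb-cong (mk≋ refl refl refl (sym (linPoly-0 s)) (λ _ → refl)))

  Gh : G (emb (coord 0# y z (S z) 1))
  Gh = 0# , y , z , 1 , sym (trans (cong (half-Q +_) (proj₂ y∃)) (solve 2 (λ q e → q :+ (e :- q) := e) refl half-Q (ι 1))) , ((λ _ _ → refl) , λ _ → refl)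

  bound : ∀ d → Trivial (γ G (suc d)) → 2 ℕ.* p ≤ d
  bound = LowerBound.bound p≢2 G b (proj₂ (proj₂ b∃)) Gb 0# y z (S z) (proj₂ z∃) Gh

3∣9Cj : ∀ j → 0 < j → j < 9 → 3 ∣ 9 C j
3∣9Cj 1 _ _ = divides 3 refl
3∣9Cj 2 _ _ = divides 12 refl
3∣9Cj 3 _ _ = divides 28 refl
3∣9Cj 4 _ _ = divides 42 refl
3∣9Cj 5 _ _ = divides 42 refl
3∣9Cj 6 _ _ = divides 28 refl
3∣9Cj 7 _ _ = divides 12 refl
3∣9Cj 8 _ _ = divides 3 refl
3∣9Cj (suc (suc (suc (suc (suc (suc (suc (suc (suc j))))))))) _ j<9 = contradiction j<9 (ℕ.≤⇒≯ (ℕ.m≤m+n 9 j))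

constructionD : (K : FiniteField) (l : ℕ) → 1 < l → FiniteField.size K ≡ 3 ℕ.^ (9 ℕ.* l) →
  let open FieldDefs K 3 in
  (μC : F) → InSub l μC → (tC : F) → tr (9 ℕ.* l) (μC * tC) ≢ 0# →
  (μB : F) → InSub l μB → μB ≢ 0# → (s : ℕ → F) (α : F) →
  Σ ℕ λ c → NilpotencyClass (GroupD l s μB μC α tC) c × 18 ≤ c × c ≤ 27
constructionD K l 1<l size≡ μC fμC tC tr≢0 μB fμB μB≢0 s α = class bound
  where
  open NilpotencyBounds K 3 (from-yes (prime? 3)) 8 l size≡ 3∣9Cj
  S : F → F
  S = linPoly n s
  exponent : F → F → F
  exponent b c = ι 2 ⁻¹ * QC n s μB c + tr n (α * c + μB * b)
  open Family 3 refl S (λ a b c e → tr n (μC * c) ≡ 0# × e ≡ exponent b c) (λ a b c e → tr n (μC * c) ≟ 0# ×-dec e ≟ exponent b c)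

  G : Elem → Set
  G = GroupD l s μB μC α tC

  -- The additional generator carries g itself, while the family supplies only powers of g³. Its
  -- c-coordinate t_C has nonzero relative trace because λ_C ≠ 0.
  h : Coord
  h = coord 0# 0# tC (S tC) 1

  exponent≡ : ∀ k → 3 ℕ.* l ℕ.* k ≡ l ℕ.* (3 ℕ.* k)
  exponent≡ k = trans (cong (ℕ._* k) (ℕ.*-comm 3 l)) (ℕ.*-assoc l 3 k)

  emb-h : emb h ≃ (E 0# 0# tC (S tC) , l)
  emb-h = mk ((λ _ _ → refl) , λ w → cong (λ m → frob m w) (ℕ.*-identityʳ l))

  generators : List Coord
  generators = h ∷ members

  Gh : G (emb h)
  Gh = gen (inj₂ (un emb-h))

  L⊆G : ∀ {x} → x ∈ generators → G (emb x)
  L⊆G (here refl) = Gh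
  L⊆G (there x∈) with members⁻ x∈
  ... | (a , b , c , k) , (tr≡0 , cond) , refl = gen (inj₁ (a , b , c , k , tr≡0 , cond , ((λ _ _ → refl) , λ w → cong (λ m → frob m w) (sym (exponent≡ k)))))

  G⊆L : ∀ {z} → G z → Covered (UpperCentralSeries.Generated ambient generators) z
  G⊆L = Gen⊆Covered (record { Q-ε = unit ; Q-∙ = mul ; Q-⁻ = inv }) λ
    { (inj₁ (a , b , c , k , tr≡0 , cond , z≈)) → let (x , x∈ , e) = members⁺ a b c k (tr≡0 , cond) (exponent≡ k) in x , gen (there x∈) , ≃-trans (mk z≈) e
    ; (inj₂ z≈) → h , gen (here refl) , ≃-trans (mk z≈) (≃-sym emb-h)
    }
    where open UpperCentralSeries ambient generators

  open FiniteGeneration G generators L⊆G G⊆L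

  b∃ : Σ F λ b → tr n (μB * b) ≡ 0# × Tr b ≢ 0#
  b∃ = ∃tr≡0∧Tr≢0 1<l μB≢0 fμB
  b : F
  b = proj₁ b∃

  Gb : G (emb (coord 0# b 0# 0# 0))
  Gb = gen (inj₁ (0# , b , 0# , 0 , trans (cong (tr n) (zeroʳ μC)) tr-0 ,
    sym (trans (cong₂ (λ u v → ι 2 ⁻¹ * u + v) (QC-0 s μB) (trans (cong (tr n) (trans (cong (_+ μB * b) (zeroʳ α)) (+-identityˡ _))) (proj₁ (proj₂ b∃)))) (trans (+-identityʳ _) (zeroʳ _))) ,
    un (≃-trans {y = emb (coord 0# b 0# (S 0#) 0)} {E 0# b 0# (S 0#) , 3 ℕ.* l ℕ.* 0}
      (emb-cong (mk≋ refl refl refl (sym (linPoly-0 s)) (λ _ → refl))) (mk ((λ _ _ → refl) , λ w → cong (λ m → frob m w) (sym (exponent≡ 0)))))))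

  bound : ∀ d → Trivial (γ G (suc d)) → 18 ≤ d
  bound = LowerBound.bound (λ ()) G b (proj₂ (proj₂ b∃)) Gb 0# 0# tC (S tC) (Tr≢0 fμC tr≢0) Gh

theorem8p8 :
  -- Construction B
  ((K : FiniteField) (p l : ℕ) → Prime p → p ≢ 2 → 1 < l →
    FiniteField.size K ≡ p N.^ (p N.* l) →
    let open FieldDefs K p in
    (s : ℕ → F) → (∀ i → InSub l (s i)) →
    (μC : F) → InSub l μC → μC ≢ 0# →
    Σ ℕ (λ c → NilpotencyClass (GroupB l s μC) c × (2 N.* p ≤ c) × (c ≤ 3 N.* p)))
  ×
  -- Construction C
  ((K : FiniteField) (p l : ℕ) → Prime p → p ≢ 2 → 1 < l →
    FiniteField.size K ≡ p N.^ (p N.* l) →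
    let open FieldDefs K p in
    (μB : F) → InSub l μB → μB ≢ 0# →
    (s : ℕ → F) → (∀ i → InSub l (s i)) →
    (∀ i → 1 ≤ i → i < p N.* l →
      μB * s i - frob i (s (p N.* l N.∸ i)) * frob i μB ≡ 0#) →
    Σ ℕ (λ c → NilpotencyClass (GroupC l s μB) c × (2 N.* p ≤ c) × (c ≤ 3 N.* p)))
  ×
  -- Construction D
  ((K : FiniteField) (l : ℕ) → 1 < l →
    FiniteField.size K ≡ 3 N.^ (9 N.* l) →
    let open FieldDefs K 3 in
    (u μC : F) → InSub (3 N.* l) u → μC ≡ u - frob l u → InSub l μC → μC ≢ 0# →
    (tC : F) → tr (9 N.* l) (μC * tC) ≢ 0# →
    (μB : F) → InSub l μB → μB ≢ 0# →
    (s : ℕ → F) → (∀ i → InSub l (s i)) →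
    (∀ i → 1 ≤ i → i < 9 N.* l →
      - (μB * s i) + frob i (s (9 N.* l N.∸ i)) * frob i μB
        ≡ μC * frob i u - u * frob i μC) →
    (α λ' : F) → InSub (3 N.* l) α → InSub 1 λ' →
    frob l α - α ≡ tr (9 N.* l) (μC * tC) * u + λ' * μC →
    Σ ℕ (λ c → NilpotencyClass (GroupD l s μB μC α tC) c × (18 ≤ c) × (c ≤ 27)))
theorem8p8 =
  (λ K p l pr p≢2 1<l size≡ s fs μC fμ μ≢0 → constructionB K p l pr p≢2 1<l size≡ s μC fμ μ≢0) ,
  (λ K p l pr p≢2 1<l size≡ μB fμ μ≢0 s fs sym-s → constructionC K p l pr p≢2 1<l size≡ μB fμ μ≢0 s) ,
  (λ K l 1<l size≡ u μC fu μC≡ fμC μC≢0 tC tr≢0 μB fμB μB≢0 s fs sym-s α λ' fα fλ α≡ →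
    constructionD K l 1<l size≡ μC fμC tC tr≢0 μB fμB μB≢0 s α)
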